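{- The graph parameters $\mathrm{tpw}$, $\overline{\mathrm{tpw}}$ and $\underline{\mathrm{tpw}}$ are (pairwise) polynomially tied.
   Context: Graphs are finite, simple and undirected. A tree-partition of a graph $G=(V,E)$ is a pair $(T,(B_i)_{i\in V(T)})$ where $T$ is a tree, $B_i\subseteq V$, for each $v\in V$ there is a unique $i(v)\in V(T)$ with $v\in B_{i(v)}$, and for every edge $uv\in E$ either $i(u)=i(v)$ or $i(u)i(v)\in E(T)$. Its width is $\max_i|B_i|$. The tree-partition-width $\mathrm{tpw}(G)$ is the minimum width of a tree-partition of $G$. A subdivision of $G$ is a graph obtained by replacing edges of $G$ by internally disjoint paths of length at least $1$ ($G$ is a subdivision of itself). $\underline{\mathrm{tpw}}(G)$ denotes the minimum, and $\overline{\mathrm{tpw}}(G)$ the maximum, of $\mathrm{tpw}(G')$ over all subdivisions $G'$ of $G$. Two parameters $\alpha,\beta$ are polynomially tied if there exist polynomial functions $f,g$ such that $\alpha\le f(\beta)$ and $\beta\le g(\alpha)$ on all graphs. -}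

module Defs where

open import Data.Bool using (Bool; false; T)
open import Data.Empty using (⊥)
open import Data.Fin using (Fin; _<_)
open import Data.Fin.Subset using (Subset; ∣_∣) renaming (_∈_ to _∈ˢ_)
open import Data.List using (List; []; _∷_; map; allFin; length; foldr)
open import Data.List.Extrema.Nat using (max)
open import Data.List.Membership.Propositional using (_∈_; _∉_)
open import Data.List.Relation.Unary.Unique.Propositional using (Unique)
open import Data.Nat using (ℕ; _+_; _*_; _≤_)
open import Data.Product using (Σ; ∃; ∃!; _×_; _,_; proj₁)
open import Data.Sum using (_⊎_)
open import Function using (_∘_)
open import Relation.Binary.Construct.Closure.ReflexiveTransitive using (Star; ε; _◅_)
open import Relation.Binary.PropositionalEquality using (_≡_)
open import Relation.Nullary using (¬_)

record Graph : Set where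
  field
    order  : ℕ
    adj    : Fin order → Fin order → Bool
    sym    : ∀ u v → adj u v ≡ adj v u
    irrefl : ∀ v → adj v v ≡ false

  Vertex : Set
  Vertex = Fin order

  Adj : Vertex → Vertex → Set
  Adj u v = T (adj u v)

  Walk : Vertex → Vertex → Set
  Walk = Star Adj

  -- Each undirected edge is represented once, by its increasing orientation.
  record Edge : Set where
    constructor edge
    field
      {src tgt} : Vertex
      src<tgt   : src < tgt
      adjacent  : Adj src tgt

open Graph using (Vertex; Adj; Walk; Edge) public
open Graph.Edge using (src; tgt) public

module _ {G : Graph} where

  vertices : ∀ {u v} → Walk G u v → List (Vertex G)
  vertices {u} ε       = u ∷ []
  vertices {u} (_ ◅ w) = u ∷ vertices w

  butLast : ∀ {u v} → Walk G u v → List (Vertex G)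
  butLast     ε       = []
  butLast {u} (_ ◅ w) = u ∷ butLast w

  interior : ∀ {u v} → Walk G u v → List (Vertex G)
  interior ε       = []
  interior (_ ◅ w) = butLast w

  IsPath : ∀ {u v} → Walk G u v → Set
  IsPath w = Unique (vertices w)

  Traverses : ∀ {u v} → Walk G u v → Vertex G → Vertex G → Set
  Traverses ε                   x y = ⊥
  Traverses (_◅_ {u} {v} _ w)   x y = (u ≡ x × v ≡ y) ⊎ Traverses w x y

-- A cycle is a path on at least three vertices whose ends are adjacent.
record Cycle (G : Graph) : Set where
  field
    {start end} : Vertex G
    walk        : Walk G start end
    isPath      : IsPath {G} walk
    long        : 3 ≤ length (vertices {G} walk)
    closing     : Adj G end start

record IsTree (G : Graph) : Set where
  field
    nonempty  : Vertex G
    connected : ∀ u v → Walk G u v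
    acyclic   : ¬ Cycle G

record TreePartition (G : Graph) : Set where
  field
    tree     : Graph
    isTree   : IsTree tree
    bag      : Vertex tree → Subset (Graph.order G)
    location : ∀ v → ∃! _≡_ λ i → v ∈ˢ bag i

  index : Vertex G → Vertex tree
  index v = proj₁ (location v)

  field
    edges : ∀ {u v} → Adj G u v →
            index u ≡ index v ⊎ Adj tree (index u) (index v)

  width : ℕ
  width = max 0 (map (∣_∣ ∘ bag) (allFin (Graph.order tree)))

-- H is, up to isomorphism, obtained from G by replacing each edge by a path.
-- The length of each path is at least 1 because its ends are distinct.
record Subdivision (G H : Graph) : Set where
  field
    branch           : Vertex G → Vertex H
    branch-injective : ∀ {u v} → branch u ≡ branch v → u ≡ v
    route            : (e : Edge G) → Walk H (branch (src e)) (branch (tgt e))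
    route-isPath     : ∀ e → IsPath {H} (route e)
    avoids-branch    : ∀ e v → branch v ∉ interior {H} (route e)
    disjoint         : ∀ {e e′ x} → x ∈ interior {H} (route e) →
                       x ∈ interior {H} (route e′) → e ≡ e′
    covers-vertices  : ∀ x → (∃ λ v → branch v ≡ x) ⊎
                             (∃ λ e → x ∈ interior {H} (route e))
    covers-edges     : ∀ {x y} → Adj H x y → ∃ λ e →
                       Traverses {H} (route e) x y ⊎ Traverses {H} (route e) y x

IsMinimum : (ℕ → Set) → ℕ → Set
IsMinimum S k = S k × (∀ {m} → S m → k ≤ m)

IsMaximum : (ℕ → Set) → ℕ → Set
IsMaximum S k = S k × (∀ {m} → S m → m ≤ k)

-- A graph parameter is given by its graph: α G k means that the value of α
-- at G is k.  Minima and maxima are unique, so the parameters below are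
-- single-valued.
GraphParameter : Set₁
GraphParameter = Graph → ℕ → Set

tpw : GraphParameter
tpw G = IsMinimum λ k → Σ (TreePartition G) λ P → TreePartition.width P ≡ k

tpwMin : GraphParameter
tpwMin G = IsMinimum λ k → Σ Graph λ H → Subdivision G H × tpw H k

tpwMax : GraphParameter
tpwMax G = IsMaximum λ k → Σ Graph λ H → Subdivision G H × tpw H k

-- Every graph has a value, in the classical sense (hence ¬ ¬): the minima and
-- maxima above range over infinite families.  For tpwMax this includes that
-- the maximum is finite.
WellDefined : GraphParameter → Set
WellDefined α = ∀ G → ¬ ¬ (∃ λ k → α G k)

-- The list c₀ ∷ c₁ ∷ ⋯ stands for c₀ + c₁x + ⋯.  Natural coefficients lose no
-- generality for upper bounds on ℕ: replace each coefficient by a natural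
-- number above its absolute value.
Polynomial : Set
Polynomial = List ℕ

⟦_⟧ : Polynomial → ℕ → ℕ
⟦ p ⟧ x = foldr (λ c r → c + x * r) 0 p

PolynomiallyBounded : GraphParameter → GraphParameter → Set
PolynomiallyBounded α β =
  Σ Polynomial λ f → ∀ G {a b} → α G a → β G b → a ≤ ⟦ f ⟧ b

PolynomiallyTied : GraphParameter → GraphParameter → Set
PolynomiallyTied α β = PolynomiallyBounded α β × PolynomiallyBounded β α

{-# OPTIONS --safe #-}

-- Let H be a subdivision of G.
--
-- From G to H: the subdivision vertices of an edge uv, with v in the bag of u
-- or in its parent bag, can be folded along a path of bags of size 2 hanging
-- off the bag of u, at the cost of adding the first and the last of them to
-- that bag.
--
-- From H to G: root the tree of a tree-partition of H of width k and remove
-- nodes from it in stages.  Invariantly, a component C of the remaining nodes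
-- is adjacent to at most two removed ones, so at most two of its nodes lie on
-- its boundary, and every route leaving C passes one of the 2k vertices in their
-- bags.  Next remove from C the boundary nodes and the nodes holding an end of a
-- route through those vertices, and close under lowest common ancestors; this
-- preserves the invariant and removes a number of nodes of C bounded in terms
-- of k.  The branch vertices in the removed nodes of C form one bag of G.  Every
-- edge of G leaving C has its end in this bag, so edges go between equal,
-- consecutive or sibling components; in the last case the route meets the layer
-- removed just before, whence few siblings are affected, and their bags are
-- merged.
module Submission where

open import Data.Bool using (false; T)
open import Data.Bool.Properties using (T-irrelevant; T?)
open import Data.Empty using (⊥)
open import Data.Fin as Fin using (Fin; zero; suc)
import Data.Fin.Properties as Finₚ
open import Data.Fin.Subset using (Subset; inside; outside; ∣_∣; _∪_; ⁅_⁆)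
  renaming (_∈_ to _∈ˢ_; ⊥ to ∅ˢ)
open import Data.Fin.Subset.Properties
  using (p⊆q⇒∣p∣≤∣q∣; ∣⁅x⁆∣≡1; x∈⁅x⁆; x∈p∪q⁺; ∣⊥∣≡0)
open import Data.List using (List; []; _∷_; _++_; map; concatMap; length; allFin; foldr)
open import Data.List.Extrema.Nat using (max≤v⁺; xs≤max)
open import Data.List.Membership.Propositional using (_∈_; _∉_)
open import Data.List.Membership.Propositional.Properties
  using (∈-map⁺; ∈-++⁺ˡ; ∈-++⁺ʳ; ∈-++⁻; ∈-allFin; ∈-concatMap⁺)
open import Data.List.Properties using (length-++; length-map)
open import Data.List.Relation.Unary.All as All using (All; []; _∷_)
import Data.List.Relation.Unary.All.Properties as Allₚ
open import Data.List.Relation.Unary.AllPairs using ([]; _∷_)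
open import Data.List.Relation.Unary.Any as Any using (here; there)
open import Data.List.Relation.Unary.Unique.Propositional using (Unique)
open import Data.List.Relation.Unary.Unique.Propositional.Properties
  using () renaming (++⁺ to unique-++⁺)
open import Data.Maybe using (Maybe; just; nothing; maybe′)
open import Data.Nat
  using (ℕ; zero; suc; _+_; _*_; _∸_; _⊓_; _≤_; _<_; z≤n; s≤s; s≤s⁻¹)
open import Data.Nat.Induction using (<-rec)
import Data.Nat.Properties as ℕ
open import Data.Nat.Solver using (module +-*-Solver)
open import Data.Product using (Σ; ∃; _×_; _,_; proj₁; proj₂)
import Data.Product.Properties as Prodₚ
open import Data.Sum as Sum using (_⊎_; inj₁; inj₂; [_,_]′; swap)
import Data.Sum.Properties as Sumₚ
open import Data.Unit using (tt)
import Data.Unit.Properties as Unitₚ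
open import Data.Vec using ([]; _∷_; tabulate; here; there)
open import Data.Vec.Properties using (lookup∘tabulate; []=⇒lookup; lookup⇒[]=)
open import Defs
open import Function using (_∘_; id; mk⇔)
open import Relation.Binary.Construct.Closure.ReflexiveTransitive
  using (Star; ε; _◅_; _◅◅_; reverse)
open import Relation.Binary.Definitions using (DecidableEquality; tri<; tri≈; tri>)
open import Relation.Binary.PropositionalEquality
  using (_≡_; _≢_; refl; sym; trans; cong; cong₂; subst; subst₂; module ≡-Reasoning)
open import Relation.Nullary using (¬_; Dec; yes; no; does; contradiction)
open import Relation.Nullary.Decidable
  using (_×-dec_; _⊎-dec_; ¬?; dec-true; dec-false; does-⇔)
open +-*-Solver using (solve; _:+_; _:*_; _:=_)

-- Counting by covering lists

AtMost : {A : Set} → ℕ → (A → Set) → Set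
AtMost n P = Σ (List _) λ xs → length xs ≤ n × (∀ {x} → P x → x ∈ xs)

private variable
  A B : Set

module _ {P Q : A → Set} where

  atMost-⊆ : ∀ {n} → (∀ {x} → Q x → P x) → AtMost n P → AtMost n Q
  atMost-⊆ Q⊆P (xs , len , covers) = xs , len , covers ∘ Q⊆P

  atMost-⊎ : ∀ {m n} → AtMost m P → AtMost n Q → AtMost (m + n) λ x → P x ⊎ Q x
  atMost-⊎ (xs , p , c) (ys , q , d) =
    xs ++ ys , ℕ.≤-trans (ℕ.≤-reflexive (length-++ xs)) (ℕ.+-mono-≤ p q) ,
    [ ∈-++⁺ˡ ∘ c , ∈-++⁺ʳ xs ∘ d ]′

atMost-≤ : ∀ {P : A → Set} {m n} → m ≤ n → AtMost m P → AtMost n P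
atMost-≤ m≤n (xs , len , covers) = xs , ℕ.≤-trans len m≤n , covers

atMost-singleton : (a : A) → AtMost 1 (_≡ a)
atMost-singleton a = a ∷ [] , ℕ.≤-refl , here

-- Bounds multiply along a chain of choices. The bag sizes below are estimated by describing each
-- vertex through such a chain.
atMost-∃ : ∀ {m n} {P : A → Set} {Q : A → B → Set} → AtMost m P →
           (∀ a → AtMost n (Q a)) → AtMost (m * n) λ b → ∃ λ a → P a × Q a b
atMost-∃ {m = m} {n} {P} {Q} (xs , len , covers) bound =
  concatMap list xs , ℕ.≤-trans (length-concatMap xs) (ℕ.*-monoˡ-≤ n len) ,
  λ (a , p , q) → ∈-concatMap⁺ list (Any.map (λ { refl → proj₂ (proj₂ (bound a)) q }) (covers p))
  where
  list : _ → List _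
  list a = proj₁ (bound a)
  length-concatMap : ∀ ys → length (concatMap list ys) ≤ length ys * n
  length-concatMap [] = z≤n
  length-concatMap (y ∷ ys) = ℕ.≤-trans (ℕ.≤-reflexive (length-++ (list y)))
    (ℕ.+-mono-≤ (proj₁ (proj₂ (bound y))) (length-concatMap ys))

atMost-image : ∀ {n} {P : A → Set} (f : A → B) → AtMost n P →
               AtMost n λ b → ∃ λ a → P a × b ≡ f a
atMost-image {n = n} f bound = subst (λ k → AtMost k _) (ℕ.*-identityʳ n)
  (atMost-∃ bound (λ a → atMost-singleton (f a)))

elements : ∀ {n} → Subset n → List (Fin n)
elements []            = []
elements (outside ∷ p) = map suc (elements p)
elements (inside  ∷ p) = zero ∷ map suc (elements p)

length-elements : ∀ {n} (p : Subset n) → length (elements p) ≡ ∣ p ∣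
length-elements []            = refl
length-elements (outside ∷ p) = trans (length-map suc (elements p)) (length-elements p)
length-elements (inside  ∷ p) =
  cong suc (trans (length-map suc (elements p)) (length-elements p))

∈-elements : ∀ {n} {p : Subset n} {x} → x ∈ˢ p → x ∈ elements p
∈-elements {p = inside  ∷ p} here        = here refl
∈-elements {p = outside ∷ p} (there x∈p) = ∈-map⁺ suc (∈-elements x∈p)
∈-elements {p = inside  ∷ p} (there x∈p) = there (∈-map⁺ suc (∈-elements x∈p))

atMost-subset : ∀ {n} (p : Subset n) → AtMost ∣ p ∣ (_∈ˢ p)
atMost-subset p = elements p , ℕ.≤-reflexive (length-elements p) , ∈-elements

∣p∪q∣≤∣p∣+∣q∣ : ∀ {n} (p q : Subset n) → ∣ p ∪ q ∣ ≤ ∣ p ∣ + ∣ q ∣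
∣p∪q∣≤∣p∣+∣q∣ []            []            = z≤n
∣p∪q∣≤∣p∣+∣q∣ (outside ∷ p) (outside ∷ q) = ∣p∪q∣≤∣p∣+∣q∣ p q
∣p∪q∣≤∣p∣+∣q∣ (inside  ∷ p) (outside ∷ q) = s≤s (∣p∪q∣≤∣p∣+∣q∣ p q)
∣p∪q∣≤∣p∣+∣q∣ (outside ∷ p) (inside  ∷ q) =
  ℕ.≤-trans (s≤s (∣p∪q∣≤∣p∣+∣q∣ p q)) (ℕ.≤-reflexive (sym (ℕ.+-suc ∣ p ∣ ∣ q ∣)))
∣p∪q∣≤∣p∣+∣q∣ (inside  ∷ p) (inside  ∷ q) =
  s≤s (ℕ.≤-trans (∣p∪q∣≤∣p∣+∣q∣ p q) (ℕ.+-monoʳ-≤ ∣ p ∣ (ℕ.n≤1+n ∣ q ∣)))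

-- The subset lies in a union of singletons, one for each entry of the list; repeated entries only
-- make this union smaller.
∣p∣≤-cover : ∀ {n m} {p : Subset n} → AtMost m (_∈ˢ p) → ∣ p ∣ ≤ m
∣p∣≤-cover {n} (xs , len , covers) =
  ℕ.≤-trans (p⊆q⇒∣p∣≤∣q∣ (∈-span ∘ covers)) (ℕ.≤-trans (∣span∣≤ xs) len)
  where
  span : List (Fin n) → Subset n
  span = foldr (λ x p → ⁅ x ⁆ ∪ p) ∅ˢ
  ∈-span : ∀ {xs x} → x ∈ xs → x ∈ˢ span xs
  ∈-span {_ ∷ xs} (here refl) = x∈p∪q⁺ (inj₁ (x∈⁅x⁆ _))
  ∈-span {_ ∷ xs} (there x∈)  = x∈p∪q⁺ (inj₂ (∈-span x∈))
  ∣span∣≤ : ∀ xs → ∣ span xs ∣ ≤ length xs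
  ∣span∣≤ []       = ℕ.≤-reflexive (∣⊥∣≡0 n)
  ∣span∣≤ (x ∷ xs) = ℕ.≤-trans (∣p∪q∣≤∣p∣+∣q∣ ⁅ x ⁆ (span xs))
    (ℕ.+-mono-≤ (ℕ.≤-reflexive (∣⁅x⁆∣≡1 x)) (∣span∣≤ xs))

module _ {G : Graph} (P : TreePartition G) where
  open TreePartition P

  width≤ : ∀ {b} → (∀ i → ∣ bag i ∣ ≤ b) → width ≤ b
  width≤ bound = max≤v⁺ z≤n (Allₚ.map⁺ (All.universal bound (allFin (Graph.order tree))))

  atMost-bag : ∀ i → AtMost width λ v → index v ≡ i
  atMost-bag i = atMost-≤ ∣bag∣≤width
    (atMost-⊆ (λ { {v} refl → proj₁ (proj₂ (location v)) }) (atMost-subset (bag i)))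
    where
    ∣bag∣≤width : ∣ bag i ∣ ≤ width
    ∣bag∣≤width = All.lookup (Allₚ.map⁻ (xs≤max 0 _)) (∈-allFin i)

-- Polynomial functions

-- Stated for functions, so that a bound is certified by combinators that follow its syntax.
IsPolynomial : (ℕ → ℕ) → Set
IsPolynomial f = Σ Polynomial λ p → ∀ x → f x ≡ ⟦ p ⟧ x

infixl 6 _⊕_
infixl 7 _⊗_

constant : ∀ c → IsPolynomial λ _ → c
constant c = c ∷ [] , λ x → sym (trans (cong (c +_) (ℕ.*-zeroʳ x)) (ℕ.+-identityʳ c))

identity : IsPolynomial λ x → x
identity = 0 ∷ 1 ∷ [] , λ x → sym (trans (cong (λ y → x * (1 + y)) (ℕ.*-zeroʳ x)) (ℕ.*-identityʳ x))

addPoly : Polynomial → Polynomial → Polynomial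
addPoly []      q       = q
addPoly (a ∷ p) []      = a ∷ p
addPoly (a ∷ p) (b ∷ q) = a + b ∷ addPoly p q

⟦addPoly⟧ : ∀ p q x → ⟦ addPoly p q ⟧ x ≡ ⟦ p ⟧ x + ⟦ q ⟧ x
⟦addPoly⟧ []      q       x = refl
⟦addPoly⟧ (a ∷ p) []      x = sym (ℕ.+-identityʳ _)
⟦addPoly⟧ (a ∷ p) (b ∷ q) x = trans (cong (λ r → a + b + x * r) (⟦addPoly⟧ p q x))
  (solve 5 (λ a b x r s → a :+ b :+ x :* (r :+ s) := a :+ x :* r :+ (b :+ x :* s))
    refl a b x (⟦ p ⟧ x) (⟦ q ⟧ x))

mulPoly : Polynomial → Polynomial → Polynomial
mulPoly []      q = []
mulPoly (a ∷ p) q = addPoly (map (a *_) q) (0 ∷ mulPoly p q)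

⟦scalePoly⟧ : ∀ a q x → ⟦ map (a *_) q ⟧ x ≡ a * ⟦ q ⟧ x
⟦scalePoly⟧ a []      x = sym (ℕ.*-zeroʳ a)
⟦scalePoly⟧ a (b ∷ q) x = trans (cong (λ r → a * b + x * r) (⟦scalePoly⟧ a q x))
  (solve 4 (λ a b x r → a :* b :+ x :* (a :* r) := a :* (b :+ x :* r)) refl a b x (⟦ q ⟧ x))

⟦mulPoly⟧ : ∀ p q x → ⟦ mulPoly p q ⟧ x ≡ ⟦ p ⟧ x * ⟦ q ⟧ x
⟦mulPoly⟧ []      q x = refl
⟦mulPoly⟧ (a ∷ p) q x = trans (⟦addPoly⟧ (map (a *_) q) (0 ∷ mulPoly p q) x)
  (trans (cong₂ (λ r s → r + x * s) (⟦scalePoly⟧ a q x) (⟦mulPoly⟧ p q x))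
    (solve 4 (λ a x r s → a :* s :+ x :* (r :* s) := (a :+ x :* r) :* s)
      refl a x (⟦ p ⟧ x) (⟦ q ⟧ x)))

_⊕_ : ∀ {f g} → IsPolynomial f → IsPolynomial g → IsPolynomial λ x → f x + g x
(p , p≡) ⊕ (q , q≡) = addPoly p q ,
  λ x → trans (cong₂ _+_ (p≡ x) (q≡ x)) (sym (⟦addPoly⟧ p q x))

_⊗_ : ∀ {f g} → IsPolynomial f → IsPolynomial g → IsPolynomial λ x → f x * g x
(p , p≡) ⊗ (q , q≡) = mulPoly p q ,
  λ x → trans (cong₂ _*_ (p≡ x) (q≡ x)) (sym (⟦mulPoly⟧ p q x))

-- Tree-partitions from parent functions

module _ {G : Graph} where

  end∈vertices : ∀ {u v} (w : Walk G u v) → v ∈ vertices {G} w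
  end∈vertices ε       = here refl
  end∈vertices (_ ◅ w) = there (end∈vertices w)

  start∈vertices : ∀ {u v} (w : Walk G u v) → u ∈ vertices {G} w
  start∈vertices ε       = here refl
  start∈vertices (_ ◅ _) = here refl

  butLast⊆vertices : ∀ {u v x} (w : Walk G u v) → x ∈ butLast {G} w → x ∈ vertices {G} w
  butLast⊆vertices (_ ◅ w) (here x≡) = here x≡
  butLast⊆vertices (_ ◅ w) (there x∈) = there (butLast⊆vertices w x∈)

  adj-sym : ∀ {u v} → Adj G u v → Adj G v u
  adj-sym {u} {v} = subst T (Graph.sym G u v)

  adj-irrefl : ∀ {v} → ¬ Adj G v v
  adj-irrefl {v} = subst T (Graph.irrefl G v)

  reverseWalk : ∀ {u v} → Walk G u v → Walk G v u
  reverseWalk = reverse adj-sym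

head∉tail : ∀ {A : Set} {x : A} {xs} → Unique (x ∷ xs) → x ∉ xs
head∉tail (x∉ ∷ _) x∈ = All.lookup x∉ x∈ refl

tail-unique : ∀ {A : Set} {x : A} {xs} → Unique (x ∷ xs) → Unique xs
tail-unique (_ ∷ u) = u

does⇒ : ∀ {P : Set} (P? : Dec P) → T (does P?) → P
does⇒ (yes p) _ = p

-- The types make `zero` the root; the decreasing rank makes every chain of parents end there.
module ParentTree {m} (par : Fin m → Fin (suc m)) (rank : Fin (suc m) → ℕ)
                  (rank-par : ∀ i → rank (par i) < rank (suc i)) where

  data Parent : Fin (suc m) → Fin (suc m) → Set where
    parent : ∀ i → Parent (suc i) (par i)

  parent? : ∀ x y → Dec (Parent x y)
  parent? zero    y = no λ ()
  parent? (suc i) y with par i Finₚ.≟ y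
  ... | yes refl = yes (parent i)
  ... | no  ≢    = no λ { (parent i) → ≢ refl }

  parent-unique : ∀ {x y z} → Parent x y → Parent x z → y ≡ z
  parent-unique (parent i) (parent i) = refl

  parent-rank : ∀ {x y} → Parent x y → rank y < rank x
  parent-rank (parent i) = rank-par i

  related? : ∀ x y → Dec (Parent x y ⊎ Parent y x)
  related? x y = parent? x y ⊎-dec parent? y x

  unrelated : ∀ x → does (related? x x) ≡ false
  unrelated x = dec-false (related? x x)
    [ (λ p → ℕ.<-irrefl refl (parent-rank p)) , (λ p → ℕ.<-irrefl refl (parent-rank p)) ]′

  tree : Graph
  tree = record
    { order  = suc m
    ; adj    = λ x y → does (related? x y)
    ; sym    = λ x y → does-⇔ (mk⇔ swap swap) (related? x y) (related? y x)
    ; irrefl = unrelated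
    }

  related : ∀ {x y} → Adj tree x y → Parent x y ⊎ Parent y x
  related {x} {y} = does⇒ (related? x y)

  adjacent : ∀ {x y} → Parent x y ⊎ Parent y x → Adj tree x y
  adjacent {x} {y} r = subst T (sym (dec-true (related? x y) r)) _

  toRoot : ∀ n x → rank x < n → Walk tree x zero
  toRoot (suc n) zero    _ = ε
  toRoot (suc n) (suc i) r = adjacent (inj₁ (parent i)) ◅
    toRoot n (par i) (ℕ.<-≤-trans (rank-par i) (s≤s⁻¹ r))

  -- A path in a parent tree first ascends and then descends: an ascent after a
  -- descent would revisit the vertex just left.
  descending : ∀ {x y z} → Parent y x → (w : Walk tree y z) → Unique (x ∷ vertices {tree} w) →
               rank x < rank z × ∃ λ p → Parent z p × p ∈ x ∷ butLast {tree} w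
  descending p ε uniq = parent-rank p , _ , p , here refl
  descending p (s ◅ w) uniq with related s
  ... | inj₁ q = contradiction (subst (_∈ _) (parent-unique q p) (there (start∈vertices w)))
                               (head∉tail uniq)
  ... | inj₂ q with descending q w (tail-unique uniq)
  ...   | lt , _ , r , p∈ = ℕ.<-trans (parent-rank p) lt , _ , r , there p∈

  -- Once a path descends it keeps descending, so it enters its end from the parent of that end; a
  -- path that never descends cannot gain rank.
  ascentOrDescent : ∀ {x z} (w : Walk tree x z) → IsPath {tree} w →
    rank z ≤ rank x ⊎ ∃ λ p → Parent z p × p ∈ butLast {tree} w
  ascentOrDescent ε uniq = inj₁ ℕ.≤-refl
  ascentOrDescent (s ◅ w) uniq with related s
  ... | inj₂ q = inj₂ (proj₂ (descending q w uniq))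
  ... | inj₁ q with ascentOrDescent w (tail-unique uniq)
  ...   | inj₁ le           = inj₁ (ℕ.≤-trans le (ℕ.<⇒≤ (parent-rank q)))
  ...   | inj₂ (_ , r , p∈) = inj₂ (_ , r , there p∈)

  noCycle : ∀ {x z} (w : Walk tree x z) → IsPath {tree} w →
            3 ≤ length (vertices {tree} w) → ¬ Adj tree z x
  noCycle ε _ (s≤s ()) _
  noCycle (_ ◅ ε) _ (s≤s (s≤s ())) _
  noCycle (s ◅ w@(s′ ◅ w′)) uniq _ closing with related s | related closing
  ... | inj₂ q | inj₂ c =
    ℕ.<-asym (proj₁ (descending q w uniq)) (parent-rank c)
  ... | inj₁ q | inj₂ c =
    head∉tail (tail-unique uniq) (subst (_∈ _) (parent-unique c q) (end∈vertices w′))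
  ... | inj₁ q | inj₁ c with ascentOrDescent w (tail-unique uniq)
  ...   | inj₁ le = ℕ.<-irrefl refl (ℕ.<-trans (parent-rank c) (ℕ.≤-<-trans le (parent-rank q)))
  ...   | inj₂ (_ , r , p∈) =
    head∉tail uniq (subst (_∈ _) (parent-unique r c) (butLast⊆vertices w p∈))
  -- Both edges at the start lead to its children. Applied from the start, `descending` could return
  -- the start itself as the parent of the end, so it is applied one vertex later, once a step
  -- straight back is excluded.
  noCycle (s ◅ (s′ ◅ w′)) uniq _ closing | inj₂ q | inj₁ c with related s′
  ... | inj₁ q′ = head∉tail uniq (subst (_∈ _) (parent-unique q′ q) (there (start∈vertices w′)))
  ... | inj₂ q′ with descending q′ w′ (tail-unique uniq)
  ...   | _ , _ , r , p∈ = head∉tail uniq (subst (_∈ _) (parent-unique r c)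
                             (butLast⊆vertices (s′ ◅ w′) p∈))

  isTree : IsTree tree
  isTree = record
    { nonempty  = zero
    ; connected = λ u v → toRoot _ u ℕ.≤-refl ◅◅ reverseWalk {tree} (toRoot _ v ℕ.≤-refl)
    ; acyclic   = λ c → let open Cycle c in noCycle walk isPath long closing
    }

-- The tree of the partition has a root with an empty bag, and a node suc v for
-- each vertex v; the part of v is the bag of the first vertex in that part.
module _ {G : Graph} {N : Set} (_≟_ : DecidableEquality N)
         (parent : N → Maybe N) (rank : N → ℕ)
         (rank-parent : ∀ {x y} → parent x ≡ just y → rank y < rank x)
         (part : Vertex G → N)
         (edges : ∀ {u v} → Adj G u v → part u ≡ part v ⊎
                  parent (part u) ≡ just (part v) ⊎ parent (part v) ≡ just (part u)) where

  private
    n = Graph.order G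

    locate : N → Fin (suc n)
    locate x with Finₚ.any? (λ v → part v ≟ x)
    ... | yes (v , _) = suc v
    -- A parent part without vertices is replaced by the root. This loses nothing, as no edge of `G`
    -- ends in such a part.
    ... | no _        = zero

    rank′ : Fin (suc n) → ℕ
    rank′ zero    = 0
    rank′ (suc v) = suc (rank (part v))

    rank-locate : ∀ x → rank′ (locate x) ≤ suc (rank x)
    rank-locate x with Finₚ.any? (λ v → part v ≟ x)
    ... | yes (v , refl) = ℕ.≤-refl
    ... | no _           = z≤n

    locate-part : ∀ v → ∃ λ w → locate (part v) ≡ suc w × part w ≡ part v
    locate-part v with Finₚ.any? (λ w → part w ≟ part v)
    ... | yes (w , eq) = w , refl , eq
    ... | no ¬any      = contradiction (v , refl) ¬any

    par : Fin n → Fin (suc n)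
    par v = maybe′ locate zero (parent (part v))

    rank-par : ∀ v → rank′ (par v) < rank′ (suc v)
    rank-par v with parent (part v) | rank-parent {part v}
    ... | just y  | below = s≤s (ℕ.≤-trans (rank-locate y) (below refl))
    ... | nothing | _     = s≤s z≤n

    module PT = ParentTree par rank′ rank-par

    index : Vertex G → Fin (suc n)
    index v = locate (part v)

    bag : Fin (suc n) → Subset n
    bag i = tabulate λ v → does (index v Finₚ.≟ i)

    ∈bag⁺ : ∀ {v i} → index v ≡ i → v ∈ˢ bag i
    ∈bag⁺ {v} {i} eq = lookup⇒[]= v _
      (trans (lookup∘tabulate _ v) (dec-true (index v Finₚ.≟ i) eq))

    ∈bag⁻ : ∀ {v i} → v ∈ˢ bag i → index v ≡ i
    ∈bag⁻ {v} {i} v∈ with index v Finₚ.≟ i | trans (sym (lookup∘tabulate _ v)) ([]=⇒lookup v∈)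
    ... | yes eq | _ = eq

    parent-index : ∀ {u v} → parent (part u) ≡ just (part v) → PT.Parent (index u) (index v)
    parent-index {u} {v} p with locate-part u
    ... | w , eq , pw = subst₂ PT.Parent (sym eq)
      (cong (maybe′ locate zero) (trans (cong parent pw) p)) (PT.parent w)

  partition : TreePartition G
  partition = record
    { tree     = PT.tree
    ; isTree   = PT.isTree
    ; bag      = bag
    ; location = λ v → index v , ∈bag⁺ refl , ∈bag⁻
    ; edges    = λ a → Sum.map (cong locate) (PT.adjacent ∘ Sum.map parent-index parent-index) (edges a)
    }

  width-partition : ∀ {b} → (∀ x → AtMost b λ v → part v ≡ x) → TreePartition.width partition ≤ b
  width-partition {b} bound = width≤ partition ∣bag∣≤b
    where
    index-suc : ∀ {v w} → index v ≡ suc w → part v ≡ part w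
    index-suc {v} eq with locate-part v
    ... | w , eq′ , pw with refl ← trans (sym eq) eq′ = sym pw

    index-zero : ∀ {v} → index v ≢ zero
    index-zero {v} eq with locate-part v
    ... | w , eq′ , pw with () ← trans (sym eq) eq′

    ∣bag∣≤b : ∀ i → ∣ bag i ∣ ≤ b
    ∣bag∣≤b zero    = ∣p∣≤-cover ([] , z≤n , λ v∈ → contradiction (∈bag⁻ v∈) index-zero)
    ∣bag∣≤b (suc w) = ∣p∣≤-cover (atMost-⊆ (index-suc ∘ ∈bag⁻) (bound (part w)))

-- Rooting a tree by breadth-first search

-- `parent` is total, and `depth-parent` constrains it only at positive depth. Its value at the root
-- is arbitrary; the depth equation in `ChildOf` excludes it.
record Rooting (T : Graph) : Set where
  field
    depth        : Vertex T → ℕ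
    parent       : Vertex T → Vertex T
    depth-parent : ∀ {t d} → depth t ≡ suc d → depth (parent t) ≡ d
    root-unique  : ∀ {s t} → depth s ≡ 0 → depth t ≡ 0 → s ≡ t

  ChildOf : Vertex T → Vertex T → Set
  ChildOf s t = depth s ≡ suc (depth t) × parent s ≡ t

  field
    childOf : ∀ {s t} → Adj T s t → ChildOf s t ⊎ ChildOf t s

least : {P : ℕ → Set} → (∀ n → Dec (P n)) → ∀ n → P n → ∃ λ m → P m × (∀ {j} → P j → m ≤ j)
least P? zero p = zero , p , λ _ → z≤n
least {P} P? (suc n) p with P? 0
... | yes p₀ = zero , p₀ , λ _ → z≤n
... | no ¬p₀ with least (P? ∘ suc) n p
...   | m , pm , minimal = suc m , pm , λ { {zero} q → contradiction q ¬p₀ ; {suc j} q → s≤s (minimal q) }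

module BreadthFirst {T : Graph} (isTree : IsTree T) where
  open IsTree isTree renaming (nonempty to root)

  -- Recursion on the number of steps, with a choice of vertex at each, makes this decidable; hence
  -- there is a least number of steps.
  Reach : ℕ → Vertex T → Set
  Reach zero    t = t ≡ root
  Reach (suc n) t = ∃ λ s → Adj T s t × Reach n s

  reach? : ∀ n t → Dec (Reach n t)
  reach? zero    t = t Finₚ.≟ root
  reach? (suc n) t = Finₚ.any? λ s → T? (Graph.adj T s t) ×-dec reach? n s

  reach-walk : ∀ {n s t} → Reach n s → Walk T s t → ∃ λ m → Reach m t
  reach-walk r ε       = _ , r
  reach-walk r (a ◅ w) = reach-walk (_ , a , r) w

  distance : ∀ t → ∃ λ d → Reach d t × (∀ {j} → Reach j t → d ≤ j)
  distance t with reach-walk {0} refl (connected root t)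
  ... | m , r = least (λ n → reach? n t) m r

  depth : Vertex T → ℕ
  depth t = proj₁ (distance t)

  reach-depth : ∀ t → Reach (depth t) t
  reach-depth t = proj₁ (proj₂ (distance t))

  depth≤ : ∀ {n t} → Reach n t → depth t ≤ n
  depth≤ {t = t} = proj₂ (proj₂ (distance t))

  depth-adj : ∀ {s t} → Adj T s t → depth t ≤ suc (depth s)
  depth-adj {s} a = depth≤ (s , a , reach-depth s)

  root-unique : ∀ {s t} → depth s ≡ 0 → depth t ≡ 0 → s ≡ t
  root-unique {s} {t} p q = trans (subst (λ n → Reach n s) p (reach-depth s))
                                  (sym (subst (λ n → Reach n t) q (reach-depth t)))

  previous : ∀ {n t} → Reach n t → Vertex T
  previous {zero}  {t} _       = t
  previous {suc n}     (s , _) = s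

  parent : Vertex T → Vertex T
  parent t = previous (reach-depth t)

  previous-reach : ∀ {n t d} (r : Reach n t) → n ≡ suc d → Adj T (previous r) t × Reach d (previous r)
  previous-reach (_ , a , r) refl = a , r

  parent-adj : ∀ {t d} → depth t ≡ suc d → Adj T (parent t) t
  parent-adj {t} eq = proj₁ (previous-reach (reach-depth t) eq)

  depth-parent : ∀ {t d} → depth t ≡ suc d → depth (parent t) ≡ d
  depth-parent {t} eq with previous-reach (reach-depth t) eq
  ... | a , r = ℕ.≤-antisym (depth≤ r) (s≤s⁻¹ (subst (_≤ suc (depth (parent t))) eq (depth-adj a)))

  vertices-▻ : ∀ {u v x} (w : Walk T u v) (a : Adj T v x) →
               vertices {T} (w ◅◅ a ◅ ε) ≡ vertices {T} w ++ x ∷ []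
  vertices-▻ ε       a = refl
  vertices-▻ (_ ◅ w) a = cong (_ ∷_) (vertices-▻ w a)

  shallow∉ : ∀ {d x ys} → All (λ y → suc d ≤ depth y) ys → depth x ≡ d → x ∉ ys
  shallow∉ deep eq x∈ = ℕ.<-irrefl (sym eq) (All.lookup deep x∈)

  -- Extend the path to the parents of its ends until these coincide.
  noLevelPath : ∀ d {u v} (w : Walk T u v) → IsPath {T} w → All (λ x → d ≤ depth x) (vertices {T} w) →
                depth u ≡ d → depth v ≡ d → u ≡ v
  noLevelPath zero    w _ _ du dv = root-unique du dv
  noLevelPath (suc d) {u} {v} w uniq deep du dv with u Finₚ.≟ v | parent u Finₚ.≟ parent v
  ... | yes eq | _ = eq
  ... | no u≢v | yes eq = contradiction cycle acyclic
    where
    long : ∀ (w : Walk T u v) → 3 ≤ suc (length (vertices {T} w))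
    long ε             = contradiction refl u≢v
    long (_ ◅ ε)       = ℕ.≤-refl
    long (_ ◅ (_ ◅ _)) = s≤s (s≤s (s≤s z≤n))
    cycle : Cycle T
    cycle = record
      { walk    = parent-adj du ◅ w
      ; isPath  = All.tabulate (λ y∈ p≡y →
          shallow∉ deep (depth-parent du) (subst (_∈ _) (sym p≡y) y∈)) ∷ uniq
      ; long    = long w
      ; closing = subst (Adj T v) (sym eq) (adj-sym {T} (parent-adj dv))
      }
  ... | no u≢v | no p≢ = contradiction
    (noLevelPath d (parent-adj du ◅ (w ◅◅ up ◅ ε))
      (All.tabulate start∉ ∷
        subst Unique (sym eq) (unique-++⁺ uniq ([] ∷ []) λ { (x∈ , here refl) → end∉ x∈ }))
      (ℕ.≤-reflexive (sym (depth-parent du)) ∷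
        subst (All _) (sym eq)
          (Allₚ.++⁺ (All.map ℕ.<⇒≤ deep) (ℕ.≤-reflexive (sym (depth-parent dv)) ∷ [])))
      (depth-parent du) (depth-parent dv)) p≢
    where
    up : Adj T v (parent v)
    up = adj-sym {T} (parent-adj dv)
    eq = vertices-▻ w up
    end∉ : parent v ∉ vertices {T} w
    end∉ = shallow∉ deep (depth-parent dv)
    start∉ : ∀ {y} → y ∈ vertices {T} (w ◅◅ up ◅ ε) → parent u ≢ y
    start∉ y∈ refl with ∈-++⁻ (vertices {T} w) (subst (parent u ∈_) eq y∈)
    ... | inj₁ x∈        = shallow∉ deep (depth-parent du) x∈
    ... | inj₂ (here p≡) = p≢ p≡

  -- Otherwise `parent t`, `t`, `s` is a path between distinct vertices of equal depth that visits
  -- nothing shallower, against `noLevelPath`.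
  child : ∀ {s t} → Adj T s t → depth t ≡ suc (depth s) → parent t ≡ s
  child {s} {t} a eq with parent t Finₚ.≟ s
  ... | yes p≡ = p≡
  ... | no p≢  = noLevelPath (depth s) (parent-adj eq ◅ adj-sym {T} a ◅ ε)
    ((parent≢ ∷ p≢ ∷ []) ∷ ((λ { refl → ℕ.1+n≢n (sym eq) }) ∷ []) ∷ [] ∷ [])
    (ℕ.≤-reflexive (sym (depth-parent eq)) ∷ ℕ.≤-trans (ℕ.n≤1+n _) (ℕ.≤-reflexive (sym eq)) ∷ ℕ.≤-refl ∷ [])
    (depth-parent eq) refl
    where
    parent≢ : parent t ≢ t
    parent≢ p≡ = ℕ.1+n≢n (trans (sym eq) (trans (cong depth (sym p≡)) (depth-parent eq)))

  depth≢ : ∀ {s t} → Adj T s t → depth s ≢ depth t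
  depth≢ {s} {t} a eq = adj-irrefl {T} (subst (Adj T s) (sym s≡t) a)
    where
    s≡t : s ≡ t
    s≡t = noLevelPath (depth s) (a ◅ ε) (((λ { refl → adj-irrefl {T} a }) ∷ []) ∷ [] ∷ [])
            (ℕ.≤-refl ∷ ℕ.≤-reflexive eq ∷ []) refl (sym eq)

  rooting : Rooting T
  rooting = record
    { depth        = depth
    ; parent       = parent
    ; depth-parent = depth-parent
    ; root-unique  = root-unique
    ; childOf      = childOf
    }
    where
    childOf : ∀ {s t} → Adj T s t → (depth s ≡ suc (depth t) × parent s ≡ t) ⊎
                                    (depth t ≡ suc (depth s) × parent t ≡ s)
    childOf {s} {t} a with ℕ.<-cmp (depth s) (depth t)
    ... | tri≈ _ eq _ = contradiction eq (depth≢ a)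
    ... | tri< lt _ _ = let eq = ℕ.≤-antisym (depth-adj a) lt in inj₂ (eq , child a eq)
    ... | tri> _ _ gt = let a′ = adj-sym {T} a; eq = ℕ.≤-antisym (depth-adj a′) gt in
                        inj₁ (eq , child a′ eq)

-- From a graph to a subdivision

module Visits (G : Graph) where

  walkLength : ∀ {u v} → Walk G u v → ℕ
  walkLength ε       = 0
  walkLength (_ ◅ w) = suc (walkLength w)

  -- At w x i j: the walk w visits x after i steps, with j steps remaining.
  data At : ∀ {u v} → Walk G u v → Vertex G → ℕ → ℕ → Set where
    here  : ∀ {u v} {w : Walk G u v} → At w u 0 (walkLength w)
    there : ∀ {u u′ v x i j} {a : Adj G u u′} {w : Walk G u′ v} →
            At w x i j → At (a ◅ w) x (suc i) j

  at-start : ∀ {u v x j} {w : Walk G u v} → At w x 0 j → x ≡ u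
  at-start here = refl

  at-end : ∀ {u v x i} {w : Walk G u v} → At w x i 0 → x ≡ v
  at-end {w = ε} here      = refl
  at-end         (there p) = at-end p

  at-∈ : ∀ {u v x i j} {w : Walk G u v} → At w x i j → x ∈ vertices {G} w
  at-∈ {w = w} here = start∈vertices w
  at-∈ (there p)    = there (at-∈ p)

  ∈⇒at : ∀ {u v x} (w : Walk G u v) → x ∈ vertices {G} w → ∃ λ i → ∃ λ j → At w x i j
  ∈⇒at ε       (here refl) = 0 , 0 , here
  ∈⇒at (_ ◅ w) (here refl) = 0 , suc (walkLength w) , here
  ∈⇒at (_ ◅ w) (there x∈) with ∈⇒at w x∈
  ... | i , j , p = suc i , j , there p

  at-unique : ∀ {u v x i j i′ j′} {w : Walk G u v} → IsPath {G} w →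
              At w x i j → At w x i′ j′ → i ≡ i′ × j ≡ j′
  at-unique uniq here      here      = refl , refl
  at-unique uniq here      (there q) = contradiction (at-∈ q) (head∉tail uniq)
  at-unique uniq (there p) here      = contradiction (at-∈ p) (head∉tail uniq)
  at-unique uniq (there p) (there q) with at-unique (tail-unique uniq) p q
  ... | refl , refl = refl , refl

  at-traverses : ∀ {u v x y} (w : Walk G u v) → Traverses {G} w x y →
                 ∃ λ i → ∃ λ j → At w x i (suc j) × At w y (suc i) j
  at-traverses (_ ◅ w) (inj₁ (refl , refl)) = 0 , walkLength w , here , there here
  at-traverses (_ ◅ w) (inj₂ t) with at-traverses w t
  ... | i , j , p , q = suc i , j , there p , there q

  butLast⇒at : ∀ {u v x} (w : Walk G u v) → x ∈ butLast {G} w → ∃ λ i → ∃ λ j → At w x i (suc j)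
  butLast⇒at (_ ◅ w) (here refl) = 0 , walkLength w , here
  butLast⇒at (_ ◅ w) (there x∈) with butLast⇒at w x∈
  ... | i , j , p = suc i , j , there p

  at⇒butLast : ∀ {u v x i j} {w : Walk G u v} → At w x i (suc j) → x ∈ butLast {G} w
  at⇒butLast {w = _ ◅ _} here = here refl
  at⇒butLast (there p)        = there (at⇒butLast p)

  interior⇒at : ∀ {u v x} (w : Walk G u v) → x ∈ interior {G} w →
                ∃ λ i → ∃ λ j → At w x (suc i) (suc j)
  interior⇒at (_ ◅ w) x∈ with butLast⇒at w x∈
  ... | i , j , p = i , j , there p

  at⇒interior : ∀ {u v x i j} {w : Walk G u v} → At w x (suc i) (suc j) → x ∈ interior {G} w
  at⇒interior (there p) = at⇒butLast p

  at-length : ∀ {u v x i j} {w : Walk G u v} → At w x i j → i + j ≡ walkLength w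
  at-length here      = refl
  at-length (there p) = cong suc (at-length p)

  visit : ∀ {u v} → Walk G u v → ℕ → Vertex G
  visit {u} w       zero    = u
  -- Past the end of the walk its last vertex is repeated.
  visit {u} ε       (suc i) = u
  visit     (_ ◅ w) (suc i) = visit w i

  at-visit : ∀ {u v x i j} {w : Walk G u v} → At w x i j → x ≡ visit w i
  at-visit {w = ε}     here = refl
  at-visit {w = _ ◅ _} here = refl
  at-visit (there p)        = at-visit p

edge-unique : ∀ {G} {e e′ : Edge G} → src e ≡ src e′ → tgt e ≡ tgt e′ → e ≡ e′
edge-unique {e = Graph.edge p a} {Graph.edge p′ a′} refl refl
  with refl ← Finₚ.<-irrelevant p p′ | refl ← T-irrelevant a a′ = refl

-- A bag of `G` keeps its `k` branch vertices and gains two vertices for each edge folded at it;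
-- both ends of such an edge are among the `k + k` vertices of two bags. The summand 2 covers the
-- bags of the new paths.
subdivideBound : ℕ → ℕ
subdivideBound k = 2 + (k + (k + k) * ((k + k) * 2))

-- Let e be an edge whose deeper end has node t.  The first and last interior
-- vertices of its route go to the bag of t; the others are folded along a new
-- path of bags of size at most 2 attached to t.
module Subdivide {G H : Graph} (S : Subdivision G H) (P : TreePartition G)
                 (R : Rooting (TreePartition.tree P)) where
  open Subdivision S
  open Visits H
  open TreePartition P renaming (edges to index-adj)
  open Rooting R

  -- A node of a new path is named by the two ends of the edge and a position, which makes equality
  -- decidable componentwise.
  Node : Set
  Node = Vertex tree ⊎ (Vertex G × Vertex G × ℕ)

  _≟_ : DecidableEquality Node
  _≟_ = Sumₚ.≡-dec Finₚ._≟_ (Prodₚ.≡-dec Finₚ._≟_ (Prodₚ.≡-dec Finₚ._≟_ ℕ._≟_))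

  deeper : Vertex G → Vertex G → Vertex tree
  deeper a b with depth (index a) ℕ.≤? depth (index b)
  ... | yes _ = index b
  ... | no _  = index a

  up : ℕ → Vertex tree → Maybe Node
  up zero    t = nothing
  up (suc _) t = just (inj₁ (parent t))

  above : Node → Maybe Node
  above (inj₁ t)               = up (depth t) t
  above (inj₂ (a , b , zero))  = just (inj₁ (deeper a b))
  above (inj₂ (a , b , suc d)) = just (inj₂ (a , b , d))

  rank : Node → ℕ
  rank (inj₁ t)           = depth t
  rank (inj₂ (a , b , d)) = suc (d + depth (deeper a b))

  rank-above : ∀ {x y} → above x ≡ just y → rank y < rank x
  rank-above {inj₁ t} eq with depth t in dt
  rank-above {inj₁ t} refl | suc d = s≤s (ℕ.≤-reflexive (depth-parent dt))
  rank-above {inj₂ (a , b , zero)}  refl = ℕ.≤-refl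
  rank-above {inj₂ (a , b , suc d)} refl = ℕ.≤-refl

  up-child : ∀ {s t} → ChildOf s t → above (inj₁ s) ≡ just (inj₁ t)
  up-child {s} (eq , refl) = cong (λ d → up d s) eq

  Near : Node → Node → Set
  Near x y = x ≡ y ⊎ above x ≡ just y ⊎ above y ≡ just x

  near-sym : ∀ {x y} → Near x y → Near y x
  near-sym (inj₁ eq) = inj₁ (sym eq)
  near-sym (inj₂ p)  = inj₂ (swap p)

  -- Level 0 is the bag of the deeper end itself, so position `d` of the new path is level `suc d`.
  fold : Edge G → ℕ → Node
  fold e zero    = inj₁ (deeper (src e) (tgt e))
  fold e (suc d) = inj₂ (src e , tgt e , d)

  -- The level of an interior vertex is its distance along the route to the nearer end, less one:
  -- the route is folded in its middle.
  place : Edge G → ℕ → ℕ → Node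
  place e zero    j       = inj₁ (index (src e))
  place e (suc i) zero    = inj₁ (index (tgt e))
  place e (suc i) (suc j) = fold e (i ⊓ j)

  near-index : ∀ {a b} → Adj G a b → Near (inj₁ (index a)) (inj₁ (index b))
  near-index a with index-adj a
  ... | inj₁ eq = inj₁ (cong inj₁ eq)
  ... | inj₂ a′ = inj₂ (Sum.map up-child up-child (childOf a′))

  near-src : ∀ e → Near (inj₁ (index (src e))) (fold e 0)
  near-src e with depth (index (src e)) ℕ.≤? depth (index (tgt e))
  ... | yes _ = near-index (Edge.adjacent e)
  ... | no _  = inj₁ refl

  near-tgt : ∀ e → Near (fold e 0) (inj₁ (index (tgt e)))
  near-tgt e with depth (index (src e)) ℕ.≤? depth (index (tgt e))
  ... | yes _ = inj₁ refl
  ... | no _  = near-index (Edge.adjacent e)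

  near-fold : ∀ e d → Near (fold e d) (fold e (suc d))
  near-fold e zero    = inj₂ (inj₂ refl)
  near-fold e (suc d) = inj₂ (inj₂ refl)

  ⊓-step : ∀ i j → i ⊓ suc j ≡ suc i ⊓ j ⊎ suc (i ⊓ suc j) ≡ suc i ⊓ j ⊎ i ⊓ suc j ≡ suc (suc i ⊓ j)
  ⊓-step zero    zero    = inj₁ refl
  ⊓-step zero    (suc j) = inj₂ (inj₁ refl)
  ⊓-step (suc i) zero    = inj₂ (inj₂ (cong suc (ℕ.⊓-zeroʳ i)))
  ⊓-step (suc i) (suc j) = Sum.map (cong suc) (Sum.map (cong suc) (cong suc)) (⊓-step i j)

  near-place : ∀ e i j → Near (place e i (suc j)) (place e (suc i) j)
  near-place e zero    zero    = near-index (Edge.adjacent e)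
  near-place e zero    (suc j) = near-src e
  near-place e (suc i) zero    = subst (λ d → Near (fold e d) _) (sym (ℕ.⊓-zeroʳ i)) (near-tgt e)
  near-place e (suc i) (suc j) with ⊓-step i j
  ... | inj₁ eq        = inj₁ (cong (fold e) eq)
  ... | inj₂ (inj₁ eq) = subst (Near (fold e _)) (cong (fold e) eq) (near-fold e _)
  ... | inj₂ (inj₂ eq) =
    near-sym {fold e _} (subst (Near (fold e _)) (cong (fold e) (sym eq)) (near-fold e _))

  Located : Vertex H → Set
  Located x = (∃ λ v → branch v ≡ x) ⊎
              (∃ λ e → ∃ λ i → ∃ λ j → At (route e) x (suc i) (suc j))

  located : ∀ x → Located x
  located x with covers-vertices x
  ... | inj₁ b        = inj₁ b
  ... | inj₂ (e , x∈) = inj₂ (e , interior⇒at (route e) x∈)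

  node : ∀ {x} → Located x → Node
  node (inj₁ (v , _))         = inj₁ (index v)
  node (inj₂ (e , i , j , _)) = place e (suc i) (suc j)

  part : Vertex H → Node
  part x = node (located x)

  node-branch : ∀ {x} v → x ≡ branch v → (l : Located x) → node l ≡ inj₁ (index v)
  node-branch v refl (inj₁ (u , eq))        = cong (inj₁ ∘ index) (branch-injective eq)
  node-branch v refl (inj₂ (e , _ , _ , p)) = contradiction (at⇒interior p) (avoids-branch e v)

  -- `located` chooses one description of a vertex. Since routes are paths with disjoint interiors
  -- that avoid the branch vertices, any position on a route yields the same node.
  node-at : ∀ {x} e i j → At (route e) x i j → (l : Located x) → node l ≡ place e i j
  node-at e zero    j       p l = node-branch (src e) (at-start p) l
  node-at e (suc i) zero    p l = node-branch (tgt e) (at-end p) l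
  node-at e (suc i) (suc j) p (inj₁ (v , refl)) = contradiction (at⇒interior p) (avoids-branch e v)
  node-at e (suc i) (suc j) p (inj₂ (e′ , i′ , j′ , p′))
    with refl ← disjoint {e} {e′} (at⇒interior p) (at⇒interior p′)
    with refl , refl ← at-unique (route-isPath e) p p′ = refl

  near-traverses : ∀ {x y} e → Traverses {H} (route e) x y → Near (part x) (part y)
  near-traverses e t with at-traverses (route e) t
  ... | i , j , p , q = subst₂ Near (sym (node-at e i (suc j) p (located _)))
                          (sym (node-at e (suc i) j q (located _))) (near-place e i j)

  edges : ∀ {x y} → Adj H x y → Near (part x) (part y)
  edges a with covers-edges a
  ... | e , inj₁ t = near-traverses e t
  ... | e , inj₂ t = near-sym {part _} (near-traverses e t)

  Folded : Vertex G → Vertex G → ℕ → Vertex H → Set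
  Folded a b d x = ∃ λ e → src e ≡ a × tgt e ≡ b ×
                   ∃ λ i → ∃ λ j → At (route e) x (suc i) (suc j) × i ⊓ j ≡ d

  -- The minimum is attained by `i` or by `j`, so the vertex lies `suc d` steps from the start or
  -- from the end of the route.
  visit-folded : ∀ {e x d i j} → At (route e) x (suc i) (suc j) → i ⊓ j ≡ d →
    x ∈ visit (route e) (suc d) ∷ visit (route e) (walkLength (route e) ∸ suc d) ∷ []
  visit-folded {e} {i = i} {j} p refl with ℕ.⊓-sel i j
  ... | inj₁ eq = here (trans (at-visit p) (cong (visit (route e) ∘ suc) (sym eq)))
  ... | inj₂ eq = there (here (trans (at-visit p) (cong (visit (route e)) (begin
    suc i                                  ≡⟨ ℕ.m+n∸n≡m (suc i) (suc j) ⟨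
    suc i + suc j ∸ suc j                  ≡⟨ cong (_∸ suc j) (at-length p) ⟩
    walkLength (route e) ∸ suc j           ≡⟨ cong (λ d → walkLength (route e) ∸ suc d) eq ⟨
    walkLength (route e) ∸ suc (i ⊓ j)     ∎))))
    where open ≡-Reasoning

  atMost-folded : ∀ a b d → AtMost 2 (Folded a b d)
  atMost-folded a b d with a Finₚ.<? b ×-dec T? (Graph.adj G a b)
  ... | no ¬e       = [] , z≤n , λ { (Graph.edge p a′ , refl , refl , _) → contradiction (p , a′) ¬e }
  ... | yes (p , e) = _ , ℕ.≤-refl , cover
    where
    w = route (Graph.edge p e)
    cover : ∀ {x} → Folded a b d x → x ∈ visit w (suc d) ∷ visit w (walkLength w ∸ suc d) ∷ []
    cover (e′ , refl , refl , i , j , q , eq)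
      with refl ← edge-unique {e = e′} {Graph.edge p e} refl refl = visit-folded q eq

  NearNode : Vertex tree → Vertex G → Set
  NearNode t v = index v ≡ t ⊎ index v ≡ parent t

  -- This limits the edges folded at `t` to pairs of vertices from two bags.
  deeper-near : ∀ {a b t} → Adj G a b → deeper a b ≡ t → NearNode t a × NearNode t b
  deeper-near {a} {b} e eq with depth (index a) ℕ.≤? depth (index b)
  deeper-near {a} {b} e refl | yes le with index-adj e
  ... | inj₁ eq = inj₁ eq , inj₁ refl
  ... | inj₂ a′ with childOf a′
  ...   | inj₁ (d , _)  = contradiction le (ℕ.<⇒≱ (ℕ.≤-reflexive (sym d)))
  ...   | inj₂ (_ , pb) = inj₂ (sym pb) , inj₁ refl
  deeper-near {a} {b} e refl | no gt with index-adj e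
  ... | inj₁ eq = inj₁ refl , inj₁ (sym eq)
  ... | inj₂ a′ with childOf a′
  ...   | inj₁ (_ , pa) = inj₁ refl , inj₂ (sym pa)
  ...   | inj₂ (d , _)  = contradiction (ℕ.<⇒≤ (ℕ.≤-reflexive (sym d))) gt

  InBag : Vertex tree → Vertex H → Set
  InBag t x = (∃ λ v → index v ≡ t × x ≡ branch v) ⊎
              (∃ λ a → NearNode t a × ∃ λ b → NearNode t b × Folded a b 0 x)

  inBag : ∀ {t x} (l : Located x) → node l ≡ inj₁ t → InBag t x
  inBag (inj₁ (v , refl)) refl = inj₁ (v , refl , refl)
  inBag (inj₂ (e , i , j , p)) eq with i ⊓ j in d
  inBag (inj₂ (e , i , j , p)) refl | zero =
    let na , nb = deeper-near (Edge.adjacent e) refl in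
    inj₂ (src e , na , tgt e , nb , e , refl , refl , i , j , p , d)

  folded : ∀ {a b d x} (l : Located x) → node l ≡ inj₂ (a , b , d) → Folded a b (suc d) x
  folded (inj₂ (e , i , j , p)) eq with i ⊓ j in d
  folded (inj₂ (e , i , j , p)) refl | suc _ = e , refl , refl , i , j , p , d

  atMost-part : ∀ n → AtMost (subdivideBound width) λ x → part x ≡ n
  atMost-part (inj₁ t) = atMost-≤ (ℕ.m≤n+m _ 2) (atMost-⊆ (inBag (located _))
    (atMost-⊎ (atMost-image branch (atMost-bag P t))
      (atMost-∃ atMost-near λ a → atMost-∃ atMost-near λ b → atMost-folded a b 0)))
    where
    atMost-near : AtMost (width + width) (NearNode t)
    atMost-near = atMost-⊎ (atMost-bag P t) (atMost-bag P (parent t))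
  atMost-part (inj₂ (a , b , d)) =
    atMost-≤ (ℕ.m≤m+n 2 _) (atMost-⊆ (folded (located _)) (atMost-folded a b (suc d)))

  subdivided : Σ (TreePartition H) λ Q → TreePartition.width Q ≤ subdivideBound width
  subdivided = partition _≟_ above rank (λ {x} → rank-above {x}) part edges ,
               width-partition _≟_ above rank (λ {x} → rank-above {x}) part edges atMost-part

-- From a subdivision to the graph

module Ancestors {T : Graph} (R : Rooting T) where
  open Rooting R

  infix 4 _⊑_

  -- The ancestor order. The depth equation in `below` keeps the arbitrary parent of the root out of
  -- it.
  data _⊑_ (s : Vertex T) : Vertex T → Set where
    here  : s ⊑ s
    below : ∀ {t d} → depth t ≡ suc d → s ⊑ parent t → s ⊑ t

  ⊑-trans : ∀ {r s t} → r ⊑ s → s ⊑ t → r ⊑ t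
  ⊑-trans p here        = p
  ⊑-trans p (below e q) = below e (⊑-trans p q)

  ⊑-depth : ∀ {s t} → s ⊑ t → depth s ≤ depth t
  ⊑-depth here = ℕ.≤-refl
  ⊑-depth {s} {t} (below {d = d} e p) = begin
    depth s          ≤⟨ ⊑-depth p ⟩
    depth (parent t) ≡⟨ depth-parent e ⟩
    d                ≤⟨ ℕ.n≤1+n d ⟩
    suc d            ≡⟨ e ⟨
    depth t          ∎
    where open ℕ.≤-Reasoning

  ⋢-parent : ∀ {t d} → depth t ≡ suc d → ¬ t ⊑ parent t
  ⋢-parent {t} {d} e p = ℕ.<-irrefl refl (begin-strict
    d                <⟨ ℕ.≤-refl ⟩
    suc d            ≡⟨ e ⟨
    depth t          ≤⟨ ⊑-depth p ⟩
    depth (parent t) ≡⟨ depth-parent e ⟩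
    d                ∎)
    where open ℕ.≤-Reasoning

  comparable : ∀ {r s t} → r ⊑ t → s ⊑ t → r ⊑ s ⊎ s ⊑ r
  comparable here        q           = inj₂ q
  comparable p           here        = inj₁ p
  comparable (below _ p) (below _ q) = comparable p q

  root⊑ : ∀ {r} d t → depth t ≡ d → depth r ≡ 0 → r ⊑ t
  root⊑ zero    t e r₀ with refl ← root-unique r₀ e = here
  root⊑ (suc d) t e r₀ = below e (root⊑ d (parent t) (depth-parent e) r₀)

  ⊑?′ : ∀ s d t → depth t ≡ d → Dec (s ⊑ t)
  ⊑?′ s d t e with s Finₚ.≟ t
  ⊑?′ s d       t e | yes refl = yes here
  ⊑?′ s zero    t e | no s≢t = no λ { here → s≢t refl ; (below e′ _) → ℕ.0≢1+n (trans (sym e) e′) }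
  ⊑?′ s (suc d) t e | no s≢t with ⊑?′ s d (parent t) (depth-parent e)
  ... | yes p = yes (below e p)
  ... | no ¬p = no λ { here → s≢t refl ; (below _ p) → ¬p p }

  _⊑?_ : ∀ s t → Dec (s ⊑ t)
  s ⊑? t = ⊑?′ s (depth t) t refl

  meet : ℕ → Vertex T → Vertex T → Vertex T
  -- The first argument is the depth of `s`; at 0 the climb has reached the root, an ancestor of
  -- every node.
  meet zero    s t = s
  meet (suc d) s t with s ⊑? t
  ... | yes _ = s
  ... | no _  = meet d (parent s) t

  meet-⊑ˡ : ∀ d s t → depth s ≡ d → meet d s t ⊑ s
  meet-⊑ˡ zero    s t e = here
  meet-⊑ˡ (suc d) s t e with s ⊑? t
  ... | yes _ = here
  ... | no _  = below e (meet-⊑ˡ d (parent s) t (depth-parent e))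

  meet-⊑ʳ : ∀ d s t → depth s ≡ d → meet d s t ⊑ t
  meet-⊑ʳ zero    s t e = root⊑ (depth t) t refl e
  meet-⊑ʳ (suc d) s t e with s ⊑? t
  ... | yes p = p
  ... | no _  = meet-⊑ʳ d (parent s) t (depth-parent e)

  meet-greatest : ∀ {r} d s t → depth s ≡ d → r ⊑ s → r ⊑ t → r ⊑ meet d s t
  meet-greatest zero    s t e p q = p
  meet-greatest (suc d) s t e p q with s ⊑? t
  ... | yes _ = p
  meet-greatest (suc d) s t e here        q | no s⋢t = contradiction q s⋢t
  meet-greatest (suc d) s t e (below _ p) q | no s⋢t = meet-greatest d (parent s) t (depth-parent e) p q

  lca : Vertex T → Vertex T → Vertex T
  lca s t = meet (depth s) s t

  lca-⊑ˡ : ∀ s t → lca s t ⊑ s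
  lca-⊑ˡ s t = meet-⊑ˡ (depth s) s t refl

  lca-⊑ʳ : ∀ s t → lca s t ⊑ t
  lca-⊑ʳ s t = meet-⊑ʳ (depth s) s t refl

  lca-greatest : ∀ {r s t} → r ⊑ s → r ⊑ t → r ⊑ lca s t
  lca-greatest {s = s} {t} = meet-greatest (depth s) s t refl

  lca-self : ∀ t → lca t t ≡ t
  lca-self t with lca t t | lca-⊑ˡ t t | lca-greatest {t} {t} {t} here here
  ... | _ | here      | _ = refl
  ... | _ | below e p | q = contradiction (⊑-trans q p) (⋢-parent e)

-- Marked: two boundary nodes, and two ends for each of the `k` vertices in each of their bags.
-- Layer: pairs of marked nodes. The last bound adds the size of the bag of one component to that of
-- a common bag, where each vertex in the layer leads to the components of its two ends.
markedBound layerBound suppressBound : ℕ → ℕ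
markedBound k = 2 + 2 * (k * 2)
layerBound k = markedBound k * (markedBound k * 1)
suppressBound k = layerBound k * k + layerBound k * (k * (2 * (layerBound k * k)))

module Suppress {G H : Graph} (S : Subdivision G H) (P : TreePartition H)
                (R : Rooting (TreePartition.tree P)) where
  open Subdivision S
  open TreePartition P renaming (tree to Tree; edges to index-adj)
  open Rooting R
  open Ancestors R
  open Visits H

  home : Vertex G → Vertex Tree
  home v = index (branch v)

  -- A branch vertex is both of its own ends, so a route that starts in a boundary bag is recorded
  -- like one that passes through it.
  end₁ end₂ : Vertex H → Vertex G
  end₁ y = [ proj₁ , src ∘ proj₁ ]′ (covers-vertices y)
  end₂ y = [ proj₁ , tgt ∘ proj₁ ]′ (covers-vertices y)

  IsEnd : Vertex G → Vertex H → Set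
  IsEnd u y = u ≡ end₁ y ⊎ u ≡ end₂ y

  end₁-branch : ∀ v → end₁ (branch v) ≡ v
  end₁-branch v with covers-vertices (branch v)
  ... | inj₁ (u , eq) = branch-injective eq
  ... | inj₂ (e , x∈) = contradiction x∈ (avoids-branch e v)

  ends-interior : ∀ {e x} → x ∈ interior {H} (route e) → IsEnd (src e) x × IsEnd (tgt e) x
  ends-interior {e} {x} x∈ with covers-vertices x
  ... | inj₁ (v , refl) = contradiction x∈ (avoids-branch e v)
  ... | inj₂ (e′ , x∈′) with refl ← disjoint {e} {e′} x∈ x∈′ = inj₁ refl , inj₂ refl

  -- Recording only the ends makes the relation symmetric, so that an edge of `G` can be followed in
  -- either direction.
  data OnRoute (u v : Vertex G) : Vertex H → Set where
    start  : OnRoute u v (branch u)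
    finish : OnRoute u v (branch v)
    inner  : ∀ {x} → IsEnd u x → IsEnd v x → OnRoute u v x

  onRoute-sym : ∀ {u v x} → OnRoute u v x → OnRoute v u x
  onRoute-sym start       = finish
  onRoute-sym finish      = start
  onRoute-sym (inner p q) = inner q p

  RouteStep : Vertex G → Vertex G → Vertex H → Vertex H → Set
  RouteStep u v x y = Adj H x y × OnRoute u v x × OnRoute u v y

  restrict : ∀ {u v x y} (w : Walk H x y) → (∀ {z} → z ∈ vertices {H} w → OnRoute u v z) →
             Star (RouteStep u v) x y
  restrict ε       on = ε
  restrict (a ◅ w) on = (a , on (here refl) , on (there (start∈vertices w))) ◅ restrict w (on ∘ there)

  route-restricted : ∀ e → Star (RouteStep (src e) (tgt e)) (branch (src e)) (branch (tgt e))
  route-restricted e = restrict (route e) (on ∘ ∈⇒at (route e))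
    where
    on : ∀ {z} → (∃ λ i → ∃ λ j → At (route e) z i j) → OnRoute (src e) (tgt e) z
    on (zero , _ , p)      with refl ← at-start p = start
    on (suc i , zero , p)  with refl ← at-end p = finish
    on (suc i , suc j , p) with ends-interior {e} (at⇒interior p)
    ... | q , r = inner q r

  link : ∀ {u v} → Adj G u v → Star (RouteStep u v) (branch u) (branch v)
  link {u} {v} a with Finₚ.<-cmp u v
  ... | tri< lt _ _   = route-restricted (Graph.edge lt a)
  ... | tri≈ _ refl _ = contradiction a (adj-irrefl {G})
  ... | tri> _ _ gt   = reverse (λ (b , p , q) → adj-sym {H} b , onRoute-sym q , onRoute-sym p)
                          (route-restricted (Graph.edge gt (adj-sym {G} a)))

  -- Removing the nodes of the tree in stages

  record Stage : Set₁ where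
    field
      Placed  : Vertex Tree → Set
      placed? : ∀ t → Dec (Placed t)

  module Staged (σ : Stage) where
    open Stage σ public

    climb : ℕ → Vertex Tree → Vertex Tree
    climb zero    t = t
    climb (suc d) t with placed? (parent t)
    ... | yes _ = t
    ... | no _  = climb d (parent t)

    -- A component of the nodes not yet placed is named by its highest node. The climb tests only
    -- parents; that the node itself is unplaced is demanded in `Inside`.
    top : Vertex Tree → Vertex Tree
    top t = climb (depth t) t

    top-root : ∀ {t} → depth t ≡ 0 → top t ≡ t
    top-root {t} e = cong (λ d → climb d t) e

    top-stop : ∀ {t d} → depth t ≡ suc d → Placed (parent t) → top t ≡ t
    top-stop {t} {d} e p = trans (cong (λ d → climb d t) e) stop
      where
      stop : climb (suc d) t ≡ t
      stop with placed? (parent t)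
      ... | yes _ = refl
      ... | no ¬p = contradiction p ¬p

    top-step : ∀ {t d} → depth t ≡ suc d → ¬ Placed (parent t) → top t ≡ top (parent t)
    top-step {t} {d} e ¬p = trans (cong (λ d → climb d t) e)
      (trans step (cong (λ d → climb d (parent t)) (sym (depth-parent e))))
      where
      step : climb (suc d) t ≡ climb d (parent t)
      step with placed? (parent t)
      ... | yes p = contradiction p ¬p
      ... | no _  = refl

    top-⊑′ : ∀ d t → depth t ≡ d → top t ⊑ t
    top-⊑′ zero    t e = subst (_⊑ t) (sym (top-root e)) here
    top-⊑′ (suc d) t e with placed? (parent t)
    ... | yes p = subst (_⊑ t) (sym (top-stop e p)) here
    ... | no ¬p = below e (subst (_⊑ parent t) (sym (top-step e ¬p)) (top-⊑′ d (parent t) (depth-parent e)))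

    top-⊑ : ∀ t → top t ⊑ t
    top-⊑ t = top-⊑′ (depth t) t refl

    Inside : Vertex Tree → Vertex Tree → Set
    Inside c t = ¬ Placed t × top t ≡ c

    inside? : ∀ c t → Dec (Inside c t)
    inside? c t = ¬? (placed? t) ×-dec (top t Finₚ.≟ c)

    -- The climb from `t` to `c` passes `s`: it can stop early only below a placed parent, and then
    -- `t` would be its own top, which is not above that parent.
    inside-between : ∀ {c s t} → Inside c t → c ⊑ s → s ⊑ t → Inside c s
    inside-between i         p here        = i
    inside-between {t = t} (¬q , refl) p (below e r) with placed? (parent t)
    ... | yes q  = contradiction (⊑-trans (subst (_⊑ _) (top-stop e q) p) r) (⋢-parent e)
    ... | no ¬q′ = inside-between (¬q′ , sym (top-step e ¬q′)) p r

    inside-top : ∀ {c t} → Inside c t → Inside c c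
    inside-top {t = t} i@(_ , refl) = inside-between i here (top-⊑ t)

    top-adj : ∀ {s t} → Adj Tree s t → ¬ Placed s → ¬ Placed t → top s ≡ top t
    top-adj a ¬s ¬t with childOf a
    ... | inj₁ (e , refl) = top-step e ¬t
    ... | inj₂ (e , refl) = sym (top-step e ¬s)

    -- The top always counts, even at the root of the whole tree. Thus every stage removes the top
    -- of every component and the process ends.
    Boundary : Vertex Tree → Set
    Boundary t = t ≡ top t ⊎ ∃ λ s → Placed s × ChildOf s t

    abstract
      boundary? : ∀ t → Dec (Boundary t)
      boundary? t = (t Finₚ.≟ top t) ⊎-dec Finₚ.any? λ s → placed? s ×-dec
        ((depth s ℕ.≟ suc (depth t)) ×-dec (parent s Finₚ.≟ t))

    boundary-adj : ∀ {s t} → Adj Tree s t → Placed t → Boundary s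
    boundary-adj {s} a pt with childOf a
    ... | inj₁ (e , refl) = inj₁ (sym (top-stop e pt))
    ... | inj₂ c          = inj₂ (_ , pt , c)

    index-inside : ∀ {c x y} → Adj H x y → Inside c (index x) → ¬ Inside c (index y) →
                   Placed (index y) × Adj Tree (index x) (index y)
    index-inside {c} {x} {y} a i@(¬p , refl) ¬i with index-adj a
    ... | inj₁ eq = contradiction (subst (Inside c) eq i) ¬i
    ... | inj₂ b with placed? (index y)
    ...   | yes q = q , b
    ...   | no ¬q = contradiction (¬q , sym (top-adj b ¬p ¬q)) ¬i

    Source : Vertex Tree → Vertex Tree → Set
    Source c t = ∃ λ y → (Inside c (index y) × Boundary (index y)) ×
                 (t ≡ home (end₁ y) ⊎ t ≡ home (end₂ y))

    Marked : Vertex Tree → Vertex Tree → Set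
    Marked c t = Inside c t × (Boundary t ⊎ Source c t)

    abstract
      marked? : ∀ c t → Dec (Marked c t)
      marked? c t = inside? c t ×-dec (boundary? t ⊎-dec Finₚ.any? λ y →
        (inside? c (index y) ×-dec boundary? (index y)) ×-dec
        ((t Finₚ.≟ home (end₁ y)) ⊎-dec (t Finₚ.≟ home (end₂ y))))

    -- Equal `a` and `b` give the marked nodes themselves. The other common ancestors separate the
    -- branches below, which is what preserves `OneExit`.
    Layer : Vertex Tree → Vertex Tree → Set
    Layer c t = ∃ λ a → Marked c a × ∃ λ b → Marked c b × t ≡ lca a b

    abstract
      layer? : ∀ c t → Dec (Layer c t)
      layer? c t = Finₚ.any? λ a → marked? c a ×-dec Finₚ.any? λ b → marked? c b ×-dec (t Finₚ.≟ lca a b)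

    marked-layer : ∀ {c t} → Marked c t → Layer c t
    marked-layer {t = t} m = t , m , t , m , sym (lca-self t)

    layer-inside : ∀ {c t} → Layer c t → Inside c t
    layer-inside (a , ma , b , mb , refl) = inside-between (proj₁ ma)
      (lca-greatest (c⊑ ma) (c⊑ mb)) (lca-⊑ˡ a b)
      where
      c⊑ : ∀ {c a} → Marked c a → c ⊑ a
      c⊑ {a = a} ((_ , refl) , _) = top-⊑ a

    top-layer : ∀ {t} → ¬ Placed t → Layer (top t) (top t)
    top-layer ¬p = let i = inside-top (¬p , refl) in marked-layer (i , inj₁ (inj₁ (sym (proj₂ i))))

    -- Follow the route to its first departure from the component: the vertex just before lies in a
    -- boundary bag and is not `branch v`, so `u` is one of its ends.
    exit : ∀ {c u v x} → Star (RouteStep u v) x (branch v) → Inside c (index x) → ¬ Inside c (home v) →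
           ∃ λ y → (Inside c (index y) × Boundary (index y)) × IsEnd u y
    exit ε i ¬i = contradiction i ¬i
    exit {c} {u} {v} (_◅_ {x} {z} (a , on , _) w) i ¬i with inside? c (index z)
    ... | yes iz = exit w iz ¬i
    ... | no ¬iz with index-inside a i ¬iz
    ...   | pz , b = x , (i , boundary-adj b pz) , isEnd on
      where
      isEnd : OnRoute u v x → IsEnd u x
      isEnd start       = inj₁ (sym (end₁-branch u))
      isEnd finish      = contradiction i ¬i
      isEnd (inner p _) = p

    -- By `exit`, `u` is an end recorded at a boundary bag, so its home is marked.
    adj-layer : ∀ {u v} → Adj G u v → ¬ Placed (home u) → ¬ Inside (top (home u)) (home v) →
                Layer (top (home u)) (home u)
    adj-layer a ¬p ¬i with exit (link a) (¬p , refl) ¬i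
    ... | y , b , e = marked-layer ((¬p , refl) , inj₂ (y , b , Sum.map (cong home) (cong home) e))

    -- The invariant in rooted form: of the at most two placed neighbours of a component one may be
    -- the parent of its top, so at most one hangs below. The depth equations make `s` and `t`
    -- genuine children.
    OneExit : Set
    OneExit = ∀ {s t} → Placed s → Placed t → depth s ≡ suc (depth (parent s)) →
              depth t ≡ suc (depth (parent t)) →
              ∀ {c} → Inside c (parent s) → Inside c (parent t) → s ≡ t

  initial : Stage
  initial = record { Placed = λ _ → ⊥ ; placed? = λ _ → no id }

  next : Stage → Stage
  next σ = record { Placed = λ t → Placed t ⊎ Layer (top t) t ; placed? = placed⁺? }
    where
    open Staged σ
    abstract
      placed⁺? : ∀ t → Dec (Placed t ⊎ Layer (top t) t)
      placed⁺? t = placed? t ⊎-dec layer? (top t) t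

  module Successive (σ : Stage) where
    open Staged σ
    module N = Staged (next σ)

    layer-placed : ∀ {c t} → Layer c t → N.Placed t
    layer-placed l with refl ← proj₂ (layer-inside l) = inj₂ l

    top-⊑-next : ∀ d t → depth t ≡ d → top t ⊑ N.top t
    top-⊑-next zero    t e = subst₂ _⊑_ (sym (top-root e)) (sym (N.top-root e)) here
    top-⊑-next (suc d) t e with N.placed? (parent t)
    ... | yes p = subst (top t ⊑_) (sym (N.top-stop e p)) (top-⊑ t)
    ... | no ¬p = subst₂ _⊑_ (sym (top-step e (¬p ∘ inj₁))) (sym (N.top-step e ¬p))
                    (top-⊑-next d (parent t) (depth-parent e))

    -- Nodes are only ever removed, so the new top `c` lies between the old top of `t` and `t`,
    -- hence in the same old component.
    inside-coarsen : ∀ {c t} → N.Inside c t → Inside (top c) t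
    inside-coarsen {t = t} (¬p , refl) = ¬p ∘ inj₁ , sym (proj₂
      (inside-between (¬p ∘ inj₁ , refl) (top-⊑-next (depth t) t refl) (N.top-⊑ t)))

    -- If `s` had been placed before, its parent would have been on the boundary and would now be
    -- placed too. So `s` is in the new layer, as a common ancestor of marked nodes.
    exit-marked : ∀ {s c} → N.Placed s → depth s ≡ suc (depth (parent s)) → N.Inside c (parent s) →
                  ∃ λ a → Marked (top c) a × s ⊑ a
    exit-marked {s} (inj₁ p) e i = contradiction
      (layer-placed (marked-layer (inside-coarsen i , inj₁ (inj₂ (s , p , e , refl))))) (proj₁ i)
    exit-marked (inj₂ l@(a , m , b , _ , s≡)) e i =
      a , subst (λ c → Marked c a) (trans (top-step e (proj₁ i ∘ inj₁)) (proj₂ (inside-coarsen i))) m ,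
      subst (_⊑ a) (sym s≡) (lca-⊑ˡ a b)

    ⊑-parent-inside : ∀ {c t d} → depth t ≡ suc d → N.Inside c (parent t) → c ⊑ t
    ⊑-parent-inside {t = t} e (_ , refl) = below e (N.top-⊑ (parent t))

    -- Two exits s ≠ t of a component with top c cannot be comparable, and then
    -- the lowest common ancestor of marked nodes below them, being in the layer,
    -- separates one of their parents from c.
    oneExit-next : N.OneExit
    oneExit-next {s} {t} ps pt es et {c} is it = oneBranch (exit-marked ps es is) (exit-marked pt et it)
      where
      ⊑⇒≡ : ∀ {s t} → N.Placed s → depth s ≡ suc (depth (parent s)) → N.Inside c (parent s) →
            N.Inside c (parent t) → s ⊑ t → s ≡ t
      ⊑⇒≡ ps es is it here        = refl
      ⊑⇒≡ ps es is it (below _ p) =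
        contradiction ps (proj₁ (N.inside-between it (⊑-parent-inside es is) p))
      sameBranch : s ⊑ t ⊎ t ⊑ s → s ≡ t
      sameBranch (inj₁ p) = ⊑⇒≡ ps es is it p
      sameBranch (inj₂ p) = sym (⊑⇒≡ pt et it is p)
      oneBranch : (∃ λ a → Marked (top c) a × s ⊑ a) → (∃ λ b → Marked (top c) b × t ⊑ b) → s ≡ t
      oneBranch (a , ma , s⊑a) (b , mb , t⊑b) with comparable s⊑a (lca-⊑ˡ a b)
      ... | inj₁ s⊑m = sameBranch (comparable (⊑-trans s⊑m (lca-⊑ʳ a b)) t⊑b)
      ... | inj₂ m⊑s with lca a b in eq
      oneBranch (a , ma , s⊑a) (b , mb , t⊑b) | inj₂ here | _ =
        sameBranch (comparable (subst (_⊑ b) eq (lca-⊑ʳ a b)) t⊑b)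
      oneBranch (a , ma , s⊑a) (b , mb , t⊑b) | inj₂ (below _ m⊑p) | m =
        contradiction (layer-placed (a , ma , b , mb , sym eq)) (proj₁ (N.inside-between is
          (subst (c ⊑_) eq (lca-greatest (⊑-trans (⊑-parent-inside es is) s⊑a)
                                         (⊑-trans (⊑-parent-inside et it) t⊑b))) m⊑p))

    -- The route cannot leave towards a node placed earlier, as the node it leaves would then have
    -- been on the old boundary and be placed by now. So it enters the new layer, at an interior
    -- vertex because the homes of `u` and `v` are unplaced.
    special-vertex : ∀ {c u v x} → Star (RouteStep u v) x (branch v) → N.Inside c (index x) →
      ¬ N.Placed (home u) → ¬ N.Placed (home v) → ¬ N.Inside c (home v) →
      ∃ λ z → Layer (top c) (index z) × IsEnd u z × IsEnd v z
    special-vertex ε i _ _ ¬i = contradiction i ¬i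
    special-vertex {c} {u} {v} (_◅_ {x} {z} (a , _ , on) w) i ¬pu ¬pv ¬i with N.inside? c (index z)
    ... | yes iz = special-vertex w iz ¬pu ¬pv ¬i
    ... | no ¬iz with N.index-inside a i ¬iz
    ...   | inj₁ pz , b = contradiction
      (layer-placed (marked-layer (inside-coarsen i , inj₁ (boundary-adj b pz)))) (proj₁ i)
    ...   | inj₂ l , b = z , subst (λ c → Layer c (index z)) top≡ l , ends on
      where
      top≡ : top (index z) ≡ top c
      top≡ = trans (sym (top-adj b (proj₁ i ∘ inj₁) (proj₁ (layer-inside l)))) (proj₂ (inside-coarsen i))
      ends : OnRoute u v z → IsEnd u z × IsEnd v z
      ends start       = contradiction (inj₂ l) ¬pu
      ends finish      = contradiction (inj₂ l) ¬pv
      ends (inner p q) = p , q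

  -- Levels, bags and their parents

  stage : ℕ → Stage
  stage zero    = initial
  stage (suc i) = next (stage i)

  module St i = Staged (stage i)
  module Su i = Successive (stage i)

  oneExit : ∀ i → St.OneExit i
  oneExit zero ()
  oneExit (suc i) = Su.oneExit-next i

  placed-mono : ∀ i j t → i ≤ j → St.Placed i t → St.Placed j t
  placed-mono i zero    t z≤n p = p
  placed-mono i (suc j) t le  p with ℕ.m≤n⇒m<n∨m≡n le
  ... | inj₁ lt   = inj₁ (placed-mono i j t (s≤s⁻¹ lt) p)
  ... | inj₂ refl = p

  -- If the parent is placed by stage `i`, then `t`, unless placed as well, is the top of its
  -- component and goes next.
  placed-depth : ∀ i t → depth t < i → St.Placed i t
  placed-depth (suc i) t lt with St.placed? i t
  ... | yes p = inj₁ p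
  ... | no ¬p = Su.layer-placed i (subst (St.Layer i _) (top≡ (depth t) refl) (St.top-layer i ¬p))
    where
    top≡ : ∀ d → depth t ≡ d → St.top i t ≡ t
    top≡ zero    e = St.top-root i e
    top≡ (suc d) e = St.top-stop i e (placed-depth i (parent t)
      (subst (_< i) (sym (depth-parent e)) (s≤s⁻¹ (subst (_< suc i) e lt))))

  abstract
    leastLevel : ∀ t → ∃ λ i → St.Placed (suc i) t × (∀ {j} → St.Placed (suc j) t → i ≤ j)
    leastLevel t = least (λ i → St.placed? (suc i) t) (depth t) (placed-depth (suc (depth t)) t ℕ.≤-refl)

  -- Nothing is placed at stage 0, so level `i` means removal between stages `i` and `suc i`.
  level : Vertex Tree → ℕ
  level t = proj₁ (leastLevel t)

  level-placed : ∀ t → St.Placed (suc (level t)) t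
  level-placed t = proj₁ (proj₂ (leastLevel t))

  level≤ : ∀ i t → St.Placed (suc i) t → level t ≤ i
  level≤ i t = proj₂ (proj₂ (leastLevel t)) {i}

  level-unplaced : ∀ i t → i ≤ level t → ¬ St.Placed i t
  level-unplaced (suc i) t le p = ℕ.<-irrefl refl (ℕ.≤-trans le (level≤ i t p))

  unplaced-level : ∀ i t → ¬ St.Placed i t → i ≤ level t
  unplaced-level i t ¬p = ℕ.≮⇒≥ λ lt → ¬p (placed-mono (suc (level t)) i t lt (level-placed t))

  -- A component's top is removed at the very next step. Its level recovers the stage, so a `Node`
  -- need not store it.
  level-top : ∀ i t → ¬ St.Placed i t → level (St.top i t) ≡ i
  level-top i t ¬p = ℕ.≤-antisym (level≤ i c (Su.layer-placed i {c} {c} l))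
                                 (unplaced-level i c (proj₁ (St.layer-inside i {c} {c} l)))
    where
    c = St.top i t
    l : St.Layer i c c
    l = St.top-layer i {t} ¬p

  level-layer : ∀ t → St.Layer (level t) (St.top (level t) t) t
  level-layer t with level-placed t
  ... | inj₁ p = contradiction p (level-unplaced (level t) t ℕ.≤-refl)
  ... | inj₂ l = l

  -- The components of stage i + 1 that are joined to each other by routes
  -- through the layer placed in between share a bag.
  Special : ℕ → Vertex Tree → Set
  Special i c = ∃ λ y → St.Layer i (St.top i c) (index y) ×
    (St.Inside (suc i) c (home (end₁ y)) ⊎ St.Inside (suc i) c (home (end₂ y)))

  abstract
    special? : ∀ i c → Dec (Special i c)
    special? i c = Finₚ.any? λ y → St.layer? i (St.top i c) (index y) ×-dec
      (St.inside? (suc i) c (home (end₁ y)) ⊎-dec St.inside? (suc i) c (home (end₂ y)))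

  -- inj₁ c is the bag of the component with top c, and inj₂ c the common bag of
  -- the special components into which the component with top c falls.
  Node : Set
  Node = Vertex Tree ⊎ Vertex Tree

  bagOf : ℕ → Vertex Tree → Node
  bagOf zero    c = inj₁ c
  bagOf (suc i) c with special? i c
  ... | yes _ = inj₂ (St.top i c)
  ... | no _  = inj₁ c

  up : ℕ → Vertex Tree → Maybe Node
  up zero    c = nothing
  up (suc i) c = just (bagOf i (St.top i c))

  above : Node → Maybe Node
  above (inj₁ c) = up (level c) c
  above (inj₂ c) = just (bagOf (level c) c)

  -- A common bag holds components one stage later than the component that names it, whence the
  -- successor.
  rank : Node → ℕ
  rank (inj₁ c) = level c
  rank (inj₂ c) = suc (level c)

  rank-bagOf : ∀ i c → level c ≡ i → rank (bagOf i c) ≡ i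
  rank-bagOf zero    c e = e
  rank-bagOf (suc i) c e with special? i c
  ... | yes _ = cong suc (level-top i c
    (level-unplaced i c (ℕ.≤-trans (ℕ.n≤1+n i) (ℕ.≤-reflexive (sym e)))))
  ... | no _  = e

  rank-above : ∀ {x y} → above x ≡ just y → rank y < rank x
  rank-above {inj₁ c} eq = rank-up (level c) refl eq
    where
    rank-up : ∀ i {y} → level c ≡ i → up i c ≡ just y → rank y < level c
    rank-up (suc i) e refl = begin-strict
      rank (bagOf i (St.top i c)) ≡⟨ rank-bagOf i (St.top i c) (level-top i c (level-unplaced i c i≤)) ⟩
      i                           <⟨ ℕ.≤-refl ⟩
      suc i                       ≡⟨ e ⟨
      level c                     ∎
      where
      open ℕ.≤-Reasoning
      i≤ : i ≤ level c
      i≤ = ℕ.≤-trans (ℕ.n≤1+n i) (ℕ.≤-reflexive (sym e))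
  rank-above {inj₂ c} refl = s≤s (ℕ.≤-reflexive (rank-bagOf (level c) c refl))

  top-coarsen : ∀ i t → ¬ St.Placed (suc i) t → St.top i t ≡ St.top i (St.top (suc i) t)
  top-coarsen i t ¬p = proj₂ (Su.inside-coarsen i {St.top (suc i) t} {t} (¬p , refl))

  -- Special or not, a component hangs from the bag of the component that contained it one stage
  -- earlier.
  above-bagOf : ∀ i t → ¬ St.Placed (suc i) t →
                above (bagOf (suc i) (St.top (suc i) t)) ≡ just (bagOf i (St.top i t))
  above-bagOf i t ¬p with special? i (St.top (suc i) t)
  ... | no _  = trans (cong (λ j → up j (St.top (suc i) t)) (level-top (suc i) t ¬p))
                  (cong (just ∘ bagOf i) (sym (top-coarsen i t ¬p)))
  ... | yes _ = cong just (trans (cong (λ c → bagOf (level c) c) (sym (top-coarsen i t ¬p)))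
                  (cong (λ j → bagOf j (St.top i t)) (level-top i t (¬p ∘ inj₁))))

  partAt : ℕ → Vertex Tree → Node
  partAt i t = bagOf i (St.top i t)

  part : Vertex G → Node
  part v = partAt (level (home v)) (home v)

  special-adj : ∀ i u v → Adj G u v → ¬ St.Placed (suc i) (home u) → ¬ St.Placed (suc i) (home v) →
    St.top (suc i) (home u) ≢ St.top (suc i) (home v) → Special i (St.top (suc i) (home u))
  special-adj i u v a ¬pu ¬pv ≢ with Su.special-vertex i {St.top (suc i) (home u)} {u} {v} (link a)
                                       (¬pu , refl) ¬pu ¬pv (λ (_ , eq) → ≢ (sym eq))
  ... | z , l , eu , _ = z , l , Sum.map ends ends eu
    where
    ends : ∀ {w} → u ≡ w → St.Inside (suc i) (St.top (suc i) (home u)) (home w)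
    ends refl = ¬pu , refl

  -- If the edge left the component, `adj-layer` would place the home of `u` by stage `suc i`.
  top-adj-home : ∀ i u v → Adj G u v → ¬ St.Placed (suc i) (home u) → ¬ St.Placed i (home v) →
                 St.top i (home u) ≡ St.top i (home v)
  top-adj-home i u v a ¬pu ¬pv with St.inside? i (St.top i (home u)) (home v)
  ... | yes (_ , eq) = sym eq
  ... | no ¬i        = contradiction
    (Su.layer-placed i {St.top i (home u)} {home u} (St.adj-layer i a (¬pu ∘ inj₁) ¬i)) ¬pu

  top-initial : ∀ d t → depth t ≡ d → depth (St.top 0 t) ≡ 0
  top-initial zero    t e = trans (cong depth (St.top-root 0 e)) e
  top-initial (suc d) t e =
    trans (cong depth (St.top-step 0 e id)) (top-initial d (parent t) (depth-parent e))

  bagOf-special : ∀ i c → Special i c → bagOf (suc i) c ≡ inj₂ (St.top i c)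
  bagOf-special i c s with special? i c
  ... | yes _ = refl
  ... | no ¬s = contradiction s ¬s

  -- At stage 0 there is one component. Later, two different components joined by an edge are both
  -- special and come from the same earlier component, which names their common bag.
  sameLevel : ∀ i u v → Adj G u v → ¬ St.Placed i (home u) → ¬ St.Placed i (home v) →
              partAt i (home u) ≡ partAt i (home v)
  sameLevel zero    u v a _   _   = cong inj₁ (root-unique (top-initial (depth (home u)) (home u) refl)
                                                           (top-initial (depth (home v)) (home v) refl))
  sameLevel (suc i) u v a ¬pu ¬pv with St.top (suc i) (home u) Finₚ.≟ St.top (suc i) (home v)
  ... | yes eq = cong (bagOf (suc i)) eq
  ... | no ≢   = begin
    partAt (suc i) (home u) ≡⟨ special-part u (special-adj i u v a ¬pu ¬pv ≢) ¬pu ⟩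
    inj₂ (St.top i (home u)) ≡⟨ cong inj₂ (top-adj-home i u v a ¬pu (¬pv ∘ inj₁)) ⟩
    inj₂ (St.top i (home v)) ≡⟨ special-part v (special-adj i v u (adj-sym {G} a) ¬pv ¬pu (≢ ∘ sym)) ¬pv ⟨
    partAt (suc i) (home v) ∎
    where
    open ≡-Reasoning
    special-part : ∀ w → Special i (St.top (suc i) (home w)) → ¬ St.Placed (suc i) (home w) →
                   partAt (suc i) (home w) ≡ inj₂ (St.top i (home w))
    special-part w s ¬pw = trans (bagOf-special i (St.top (suc i) (home w)) s)
                             (cong inj₂ (sym (top-coarsen i (home w) ¬pw)))

  lowerLevel : ∀ u v → Adj G u v → level (home u) < level (home v) → above (part v) ≡ just (part u)
  lowerLevel u v a lt = begin
    above (part v)                  ≡⟨ cong (λ j → above (partAt j (home v))) level≡ ⟩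
    above (partAt (suc i) (home v)) ≡⟨ above-bagOf i (home v) ¬pv ⟩
    just (partAt i (home v))        ≡⟨ cong (just ∘ bagOf i) (top-adj-home i v u (adj-sym {G} a) ¬pv
                                         (level-unplaced i (home u) ℕ.≤-refl)) ⟩
    just (part u)                   ∎
    where
    open ≡-Reasoning
    i = level (home u)
    ¬pv : ¬ St.Placed (suc i) (home v)
    ¬pv = level-unplaced (suc i) (home v) lt
    -- The home of `u` is placed by stage `suc i`, so the edge leaves the component of `v` there,
    -- and `adj-layer` forces `v` into the next layer.
    level≡ : level (home v) ≡ suc i
    level≡ = ℕ.≤-antisym (level≤ (suc i) (home v)
      (Su.layer-placed (suc i) {St.top (suc i) (home v)} {home v}
        (St.adj-layer (suc i) (adj-sym {G} a) ¬pv λ (¬pu , _) → ¬pu (level-placed (home u))))) lt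

  edges : ∀ {u v} → Adj G u v →
          part u ≡ part v ⊎ above (part u) ≡ just (part v) ⊎ above (part v) ≡ just (part u)
  edges {u} {v} a with ℕ.<-cmp (level (home u)) (level (home v))
  ... | tri< lt _ _ = inj₂ (inj₂ (lowerLevel u v a lt))
  ... | tri> _ _ gt = inj₂ (inj₁ (lowerLevel v u (adj-sym {G} a) gt))
  ... | tri≈ _ eq _ = inj₁ (trans
    (sameLevel i u v a (level-unplaced i (home u) ℕ.≤-refl)
      (level-unplaced i (home v) (ℕ.≤-reflexive eq)))
    (cong (λ i → partAt i (home v)) eq))
    where
    i = level (home u)

  -- Sizes of the new bags

  atMost-home : ∀ t → AtMost width λ v → home v ≡ t
  atMost-home t = atMost-⊆ (λ {v} eq → branch v , eq , sym (end₁-branch v))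
                    (atMost-image end₁ (atMost-bag P t))

  -- The candidates are the top and the parent of the only exit below, by `oneExit`.
  atMost-boundary : ∀ i c → AtMost 2 λ t → St.Inside i c t × St.Boundary i t
  atMost-boundary i c with Finₚ.any? (λ s → St.placed? i s ×-dec
    ((depth s ℕ.≟ suc (depth (parent s))) ×-dec St.inside? i c (parent s)))
  ... | no none = c ∷ [] , s≤s z≤n , λ
    { ((_ , refl) , inj₁ t≡)             → here t≡
    ; (it , inj₂ (s , ps , e , refl))    → contradiction (s , ps , e , it) none }
  ... | yes (s , ps , e , is) = c ∷ parent s ∷ [] , ℕ.≤-refl , λ
    { ((_ , refl) , inj₁ t≡)             → here t≡
    ; (it , inj₂ (s′ , ps′ , e′ , refl)) → there (here (cong parent (oneExit i ps′ ps e′ e it is))) }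

  atMost-ends : (f : Vertex G → Vertex Tree) (y : Vertex H) →
                AtMost 2 λ t → t ≡ f (end₁ y) ⊎ t ≡ f (end₂ y)
  atMost-ends f y = atMost-⊎ (atMost-singleton _) (atMost-singleton _)

  atMost-marked : ∀ i c → AtMost (markedBound width) (St.Marked i c)
  atMost-marked i c = atMost-⊆
    (λ { (it , inj₁ b) → inj₁ (it , b) ; (_ , inj₂ (y , b , e)) → inj₂ (index y , b , y , refl , e) })
    (atMost-⊎ (atMost-boundary i c)
      (atMost-∃ (atMost-boundary i c) λ s → atMost-∃ (atMost-bag P s) (atMost-ends home)))

  atMost-layer : ∀ i c → AtMost (layerBound width) (St.Layer i c)
  atMost-layer i c = atMost-∃ (atMost-marked i c) λ a →
    atMost-∃ (atMost-marked i c) λ b → atMost-singleton (lca a b)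

  atMost-component : ∀ i c → AtMost (layerBound width * width) λ v → ∃ λ t → St.Layer i c t × home v ≡ t
  atMost-component i c = atMost-∃ (atMost-layer i c) atMost-home

  -- `InSpecial` spells out the choices to be counted: a layer node, a vertex in its bag, an end of
  -- that vertex, and a vertex in the layer of the component of that end.
  InComponent InSpecial : ℕ → Vertex Tree → Vertex G → Set
  InComponent i c v = ∃ λ t → St.Layer i c t × home v ≡ t
  InSpecial i c v = ∃ λ s → St.Layer i c s × ∃ λ y → index y ≡ s ×
    ∃ λ c′ → (c′ ≡ St.top (suc i) (home (end₁ y)) ⊎ c′ ≡ St.top (suc i) (home (end₂ y))) ×
    InComponent (suc i) c′ v

  InBag : Node → Vertex G → Set
  InBag (inj₁ c) = InComponent (level c) c
  InBag (inj₂ c) = InSpecial (level c) c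

  inBag : ∀ i v → St.Layer i (St.top i (home v)) (home v) → InBag (partAt i (home v)) v
  inBag zero    v l = subst (λ j → InComponent j (St.top 0 (home v)) v)
                        (sym (level-top 0 (home v) id)) (home v , l , refl)
  inBag (suc i) v l with special? i (St.top (suc i) (home v))
  ... | no _ = subst (λ j → InComponent j (St.top (suc i) (home v)) v)
    (sym (level-top (suc i) (home v) (proj₁ (St.layer-inside (suc i) l)))) (home v , l , refl)
  ... | yes (y , ly , ends) = subst (λ j → InSpecial j (St.top i c) v)
    (sym (level-top i c (proj₁ (St.inside-top (suc i) (St.layer-inside (suc i) l)) ∘ inj₁)))
    (index y , ly , y , refl , c , Sum.map (sym ∘ proj₂) (sym ∘ proj₂) ends , home v , l , refl)
    where
    c = St.top (suc i) (home v)

  inPart : ∀ {x v} → part v ≡ x → InBag x v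
  inPart {v = v} refl = inBag (level (home v)) v (level-layer (home v))

  atMost-part : ∀ x → AtMost (suppressBound width) λ v → part v ≡ x
  atMost-part (inj₁ c) = atMost-≤ (ℕ.m≤m+n _ _) (atMost-⊆ inPart
    (atMost-component (level c) c))
  atMost-part (inj₂ c) = atMost-≤ (ℕ.m≤n+m _ (layerBound width * width)) (atMost-⊆ inPart
    (atMost-∃ (atMost-layer (level c) c) λ s → atMost-∃ (atMost-bag P s) λ y →
      atMost-∃ (atMost-ends (St.top (suc (level c)) ∘ home) y) λ c′ → atMost-component (suc (level c)) c′))

  suppressed : Σ (TreePartition G) λ Q → TreePartition.width Q ≤ suppressBound width
  suppressed = partition _≟_ above rank (λ {x} → rank-above {x}) part edges ,
               width-partition _≟_ above rank (λ {x} → rank-above {x}) part edges atMost-part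
    where
    _≟_ : DecidableEquality Node
    _≟_ = Sumₚ.≡-dec Finₚ._≟_ Finₚ._≟_

-- The parameters

polynomial-subdivideBound : ∀ {f} → IsPolynomial f → IsPolynomial (λ x → subdivideBound (f x))
polynomial-subdivideBound p = constant 2 ⊕ (p ⊕ (p ⊕ p) ⊗ ((p ⊕ p) ⊗ constant 2))

polynomial-suppressBound : IsPolynomial suppressBound
polynomial-suppressBound = layer ⊗ identity ⊕ layer ⊗ (identity ⊗ (constant 2 ⊗ (layer ⊗ identity)))
  where
  marked : IsPolynomial markedBound
  marked = constant 2 ⊕ constant 2 ⊗ (identity ⊗ constant 2)
  layer : IsPolynomial layerBound
  layer = marked ⊗ (marked ⊗ constant 1)

subdivideBound-mono : ∀ {j k} → j ≤ k → subdivideBound j ≤ subdivideBound k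
subdivideBound-mono le = ℕ.+-monoʳ-≤ 2 (ℕ.+-mono-≤ le
  (ℕ.*-mono-≤ (ℕ.+-mono-≤ le le) (ℕ.*-monoˡ-≤ 2 (ℕ.+-mono-≤ le le))))

subdivision-refl : ∀ G → Subdivision G G
subdivision-refl G = record
  { branch           = id
  ; branch-injective = id
  ; route            = λ e → Edge.adjacent e ◅ ε
  ; route-isPath     = λ e → ((λ eq → ℕ.<-irrefl (cong Fin.toℕ eq) (Edge.src<tgt e)) ∷ []) ∷ [] ∷ []
  ; avoids-branch    = λ _ _ ()
  ; disjoint         = λ ()
  ; covers-vertices  = λ x → inj₁ (x , refl)
  ; covers-edges     = covers
  }
  where
  covers : ∀ {x y} → Adj G x y → ∃ λ e → Traverses {G} (Edge.adjacent e ◅ ε) x y ⊎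
                                         Traverses {G} (Edge.adjacent e ◅ ε) y x
  covers {x} {y} a with Finₚ.<-cmp x y
  ... | tri< lt _ _   = Graph.edge lt a , inj₁ (inj₁ (refl , refl))
  ... | tri≈ _ refl _ = contradiction a (adj-irrefl {G})
  ... | tri> _ _ gt   = Graph.edge gt (adj-sym {G} a) , inj₂ (inj₁ (refl , refl))

module _ {G H : Graph} (S : Subdivision G H) where
  open TreePartition using (width)

  subdivide : (P : TreePartition G) → Σ (TreePartition H) λ Q → width Q ≤ subdivideBound (width P)
  subdivide P = Subdivide.subdivided S P (BreadthFirst.rooting (TreePartition.isTree P))

  suppress : (P : TreePartition H) → Σ (TreePartition G) λ Q → width Q ≤ suppressBound (width P)
  suppress P = Suppress.suppressed S P (BreadthFirst.rooting (TreePartition.isTree P))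

tpw≤width : ∀ {G k b} → tpw G k → (Σ (TreePartition G) λ P → TreePartition.width P ≤ b) → k ≤ b
tpw≤width (_ , minimal) (P , le) = ℕ.≤-trans (minimal (P , refl)) le

tpw-subdivision : ∀ {G H k l} → Subdivision G H → tpw G k → tpw H l → l ≤ subdivideBound k
tpw-subdivision S ((P , refl) , _) l = tpw≤width l (subdivide S P)

oneBag : ∀ G → TreePartition G
oneBag G = partition Unitₚ._≟_ (λ _ → nothing) (λ _ → 0) (λ ()) (λ _ → tt) (λ _ → inj₁ refl)

minimum-exists : ∀ {S : ℕ → Set} {n} → S n → ¬ ¬ ∃ (IsMinimum S)
minimum-exists {S} {n} s none = <-rec (λ n → ¬ S n) step n s
  where
  step : ∀ n → (∀ {m} → m < n → ¬ S m) → ¬ S n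
  step n below s = none (n , s , λ t → ℕ.≮⇒≥ λ lt → below lt t)

-- Minimise the distance to the bound `b`; no subtraction is truncated, as all members are at most
-- `b`.
maximum-exists : ∀ {S : ℕ → Set} {n b} → S n → (∀ {m} → S m → m ≤ b) → ¬ ¬ ∃ (IsMaximum S)
maximum-exists {S} {n} {b} s bounded none = minimum-exists {Codistance} (n , s , refl) λ
  { (_ , (m , t , refl) , minimal) → none (m , t , λ {m′} t′ →
      ℕ.∸-cancelʳ-≤ (bounded t′) (minimal (m′ , t′ , refl))) }
  where
  Codistance : ℕ → Set
  Codistance j = ∃ λ m → S m × j ≡ b ∸ m

tpw-exists : WellDefined tpw
tpw-exists G = minimum-exists (oneBag G , refl)

tpwMin-exists : WellDefined tpwMin
tpwMin-exists G none = tpw-exists G λ (k , t) →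
  minimum-exists (G , subdivision-refl G , t) none

tpwMax-exists : WellDefined tpwMax
tpwMax-exists G none = tpw-exists G λ (k , t) →
  maximum-exists (G , subdivision-refl G , t) (λ (H , S , u) → tpw-subdivision S t u) none

bounded-by : ∀ {α β f} → IsPolynomial f → (∀ G {a b} → α G a → β G b → a ≤ f b) →
             PolynomiallyBounded α β
bounded-by (p , eq) bound = p , λ G {a} {b} α β → subst (a ≤_) (eq b) (bound G α β)

tpw≤tpwMax : PolynomiallyBounded tpw tpwMax
tpw≤tpwMax = bounded-by identity λ G t (_ , maximal) → maximal (G , subdivision-refl G , t)

tpwMax≤tpw : PolynomiallyBounded tpwMax tpw
tpwMax≤tpw = bounded-by (polynomial-subdivideBound identity) λ
  { G ((H , S , u) , _) t → tpw-subdivision S t u }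

tpw≤tpwMin : PolynomiallyBounded tpw tpwMin
tpw≤tpwMin = bounded-by polynomial-suppressBound λ
  { G t ((H , S , (P , refl) , _) , _) → tpw≤width t (suppress S P) }

tpwMin≤tpw : PolynomiallyBounded tpwMin tpw
tpwMin≤tpw = bounded-by identity λ G (_ , minimal) t → minimal (G , subdivision-refl G , t)

-- The constructions are composed on tree-partitions, from one subdivision through `G` to the other,
-- since a value of `tpw G` is available only under double negation.
tpwMax≤tpwMin : PolynomiallyBounded tpwMax tpwMin
tpwMax≤tpwMin = bounded-by (polynomial-subdivideBound polynomial-suppressBound) λ
  { G ((H , S , u) , _) ((H′ , S′ , (P′ , refl) , _) , _) →
      let P , P≤ = suppress S′ P′
          Q , Q≤ = subdivide S P
      in tpw≤width u (Q , ℕ.≤-trans Q≤ (subdivideBound-mono P≤)) }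

tpwMin≤tpwMax : PolynomiallyBounded tpwMin tpwMax
tpwMin≤tpwMax = bounded-by identity λ G (_ , minimal) (s , _) → minimal s

corollary5p5 : (WellDefined tpw × WellDefined tpwMax × WellDefined tpwMin) ×
    PolynomiallyTied tpw tpwMax ×
    PolynomiallyTied tpw tpwMin ×
    PolynomiallyTied tpwMax tpwMin
corollary5p5 =
  (tpw-exists , tpwMax-exists , tpwMin-exists) ,
  (tpw≤tpwMax , tpwMax≤tpw) , (tpw≤tpwMin , tpwMin≤tpw) , (tpwMax≤tpwMin , tpwMin≤tpwMax)
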